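{- Let $T\neq P_n$ be a tree on $n$ vertices with diameter $D$. Among all diametric paths of $T$ (with both orientations), choose $P=v_0v_1\ldots v_D$ so that the first branching vertex on $P$ (counting from $v_0$) is as far as possible from $v_0$, and let $v_i$ be this first branching vertex. If $D>2$, $i=1$ and $\deg(v_{2})>2$, let $u=v_{2}$; otherwise let $u=v_i$. Let $w_1,\ldots,w_k$ be $k$ neighbors of $u$ not lying on $P$, where $1\leq k\leq \deg(u)-2$. Let $T'$ be the tree obtained from $T$ by deleting the edges $uw_1,\ldots,uw_k$ and adding the edges $v_0w_1,\ldots,v_0w_k$. Then $\xi^{ac}(T)>\xi^{ac}(T')$.
   Context: All graphs are simple and connected. $d(u,v)$ is the distance, $\varepsilon(u)=\max_v d(u,v)$ the eccentricity, and the diameter $D$ the maximum distance. A path $v_0\ldots v_D$ with $d(v_0,v_D)=D$ is diametric. A vertex of a tree is branching if its degree is at least $3$. $M(u)$ is the product of the degrees of all neighbors of $u$, and $\xi^{ac}(G)=\sum_{u\in V(G)}\frac{M(u)}{\varepsilon(u)}$. $P_n$ is the path on $n$ vertices. -}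

module Defs where

open import Data.Nat using (ℕ; zero; suc; _+_; _*_; _∸_; _⊔_; _≤_; _<_)
open import Data.Bool using (Bool; true; false; _∧_; _∨_; not; if_then_else_)
open import Data.Fin using (Fin; toℕ)
open import Data.Fin.Properties using (_≟_)
open import Data.List using (List; map; foldr; allFin)
open import Data.Nat.ListAction using (sum; product)
open import Data.Bool.ListAction using (any)
open import Data.Integer using (+_)
open import Data.Rational using (ℚ; 0ℚ; _/_) renaming (_+_ to _+ℚ_)
open import Relation.Nullary.Decidable using (⌊_⌋)
open import Relation.Binary.PropositionalEquality using (_≡_; _≢_)
open import Relation.Nullary using (¬_)
open import Data.Product using (Σ; _×_)
open import Function.Bundles using (_↔_; Inverse)
import Data.Nat as ℕ

Graph : ℕ → Set
Graph n = Fin n → Fin n → Bool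

_==_ : ∀ {n} → Fin n → Fin n → Bool
x == y = ⌊ x ≟ y ⌋

count : ∀ {n} → (Fin n → Bool) → ℕ
count {n} p = sum (map (λ x → if p x then 1 else 0) (allFin n))

deg : ∀ {n} → Graph n → Fin n → ℕ
deg G x = count (G x)

M : ∀ {n} → Graph n → Fin n → ℕ
M {n} G u = product (map (λ y → if G u y then deg G y else 1) (allFin n))

reach : ∀ {n} → Graph n → Fin n → ℕ → Fin n → Bool
reach G u zero y = y == u
reach {n} G u (suc k) y = reach G u k y ∨ any (λ x → reach G u k x ∧ G x y) (allFin n)

-- least k < fuel with p k, or fuel if there is none
firstTrue : (ℕ → Bool) → ℕ → ℕ
firstTrue p zero = zero
firstTrue p (suc f) = if p 0 then 0 else suc (firstTrue (λ k → p (suc k)) f)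

-- graph distance (in a connected graph on n vertices every distance is < n)
dist : ∀ {n} → Graph n → Fin n → Fin n → ℕ
dist {n} G u v = firstTrue (λ k → reach G u k v) n

maxOver : ∀ {n} → (Fin n → ℕ) → ℕ
maxOver {n} f = foldr _⊔_ 0 (map f (allFin n))

ecc : ∀ {n} → Graph n → Fin n → ℕ
ecc G u = maxOver (dist G u)

diam : ∀ {n} → Graph n → ℕ
diam G = maxOver (ecc G)

-- M(u)/ε(u); ε(u) = 0 only for the one-vertex graph (then the term is set to 0)
term : ∀ {n} → Graph n → Fin n → ℚ
term G u with ecc G u
... | zero = 0ℚ
... | suc e = (+ M G u) / suc e

xiac : ∀ {n} → Graph n → ℚ
xiac {n} G = foldr _+ℚ_ 0ℚ (map (term G) (allFin n))

Symmetric : ∀ {n} → Graph n → Set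
Symmetric G = ∀ x y → G x y ≡ G y x

Irreflexive : ∀ {n} → Graph n → Set
Irreflexive G = ∀ x → G x x ≡ false

Connected : ∀ {n} → Graph n → Set
Connected {n} G = ∀ u v → reach G u n v ≡ true

-- number of ordered adjacent pairs = 2 · (number of edges)
orderedEdges : ∀ {n} → Graph n → ℕ
orderedEdges {n} G = sum (map (λ x → deg G x) (allFin n))

IsTree : ∀ {n} → Graph n → Set
IsTree {n} G = Symmetric G × Irreflexive G × Connected G × orderedEdges G ≡ 2 * (n ∸ 1)

pathGraph : ∀ n → Graph n
pathGraph n x y = ⌊ suc (toℕ x) ℕ.≟ toℕ y ⌋ ∨ ⌊ suc (toℕ y) ℕ.≟ toℕ x ⌋

Isomorphic : ∀ {n} → Graph n → Graph n → Set
Isomorphic {n} G H = Σ (Fin n ↔ Fin n) λ σ → ∀ x y → G x y ≡ H (Inverse.to σ x) (Inverse.to σ y)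

-- P (read at indices 0..D) is a diametric path v_0 … v_D of G, D = diam G
Diametric : ∀ {n} → Graph n → (ℕ → Fin n) → Set
Diametric G P = (∀ k → k < diam G → G (P k) (P (suc k)) ≡ true) × dist G (P 0) (P (diam G)) ≡ diam G

Branching : ∀ {n} → Graph n → Fin n → Set
Branching G x = 3 ≤ deg G x

FirstBranch : ∀ {n} → Graph n → (ℕ → Fin n) → ℕ → Set
FirstBranch G P j = j ≤ diam G × Branching G (P j) × (∀ k → k < j → ¬ Branching G (P k))

inW : ∀ {n k} → (Fin k → Fin n) → Fin n → Bool
inW {k = k} W x = any (λ j → W j == x) (allFin k)

moveEdges : ∀ {n k} → Graph n → Fin n → Fin n → (Fin k → Fin n) → Graph n
moveEdges G u v0 W x y =
  (G x y ∧ not ((x == u ∧ inW W y) ∨ (y == u ∧ inW W x)))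
  ∨ ((x == v0 ∧ inW W y) ∨ (y == v0 ∧ inW W x))

{-# OPTIONS --safe #-}
-- Write D for the diameter, u = v_j, d = deg u, and ε, ε′ and M, M′ for the eccentricities and
-- neighbour-degree products in T and in the new tree.
--
-- First, ε ≤ ε′: by the four-point condition a farthest vertex of T can be taken to be v₀ or
-- v_D; distances to these do not shrink for vertices outside the moved branches, and a vertex x
-- in a moved branch ends up at distance D + d(u,x) from v_D.  Hence it is enough to compare the
-- sums of M′/ε and M/ε, which after multiplication by D! is an inequality in ℕ between sums
-- with weights c(x) = D!/ε(x).
--
-- M can increase only at v₀ and v₁.  If j ≥ 2, then the product of the degrees of the w's is
-- moved from M(u) to M(v₀), where it counts less since ε(v₀) = D; if j = 1, then the w's are
-- leaves.  The increase at v₁ is at most k deg(v₂)/(D−1), or k(d−k−1)/(D−1) if j = 2, because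
-- the neighbours of v₁ other than v₂ are leaves.  It is outweighed by the decrease at the
-- neighbours of u: at least (d−k−1)/D at each w and k/D at each neighbour that stays, together
-- 2k(d−k−1)/D and the contribution of one further neighbour of u.  Here 2/D ≥ 1/(D−1), strictly
-- so if D > 2.
module Submission where

open import Defs
open import Algebra.Properties.CommutativeMonoid.Sum as CMSum using ()
open import Data.Bool using (Bool; true; false; _∧_; _∨_; not; if_then_else_)
open import Data.Bool.ListAction using (any)
open import Data.Bool.Properties using (T-≡; ∧-zeroʳ; ∨-identityʳ; ∧-identityʳ; ¬-not)
open import Data.Fin using (Fin; zero; suc)
import Data.Fin.Properties as Fin
import Data.Integer as ℤ
import Data.Integer.Properties as ℤ
open import Data.List as List using ([]; _∷_; map; foldr; allFin)
open import Data.List.Membership.Propositional using (lose)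
open import Data.List.Membership.Propositional.Properties using (∈-allFin)
open import Data.List.Properties using (map-tabulate)
open import Data.List.Relation.Unary.Any using (satisfied)
open import Data.List.Relation.Unary.Any.Properties using (any⁺; any⁻)
open import Data.Nat
open import Data.Nat.Divisibility using (_∣_; ∣-trans; m∣m*n; m≤n⇒m!∣n!)
open import Data.Nat.ListAction using (sum; product)
open import Data.Nat.Properties
open import Data.Nat.Tactic.RingSolver using (solve-∀)
open import Data.Product using (∃; _×_; _,_; proj₁; proj₂)
open import Data.Rational using (ℚ; 0ℚ; toℚᵘ) renaming (_+_ to _+ℚ_; _<_ to _<ℚ_; _≤_ to _≤ℚ_; _/_ to _/ℚ_)
import Data.Rational.Properties as ℚ
import Data.Rational.Unnormalised as ℚᵘ
open import Data.Rational.Unnormalised using (mkℚᵘ; *≡*; *≤*; *<*)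
import Data.Rational.Unnormalised.Properties as ℚᵘ
open import Data.Sum using (_⊎_; inj₁; inj₂)
open import Function using (_∘_; id)
open import Function.Bundles using (Equivalence)
open import Function.Definitions using (Injective)
open import Relation.Binary.PropositionalEquality
open import Relation.Nullary using (¬_; Dec; yes; no; contradiction)
open import Relation.Nullary.Decidable using (⌊_⌋)

open CMSum +-0-commutativeMonoid
  renaming (sum to ∑; sum-cong-≗ to ∑-cong)
  using (∑-distrib-+; ∑-comm)
open CMSum *-1-commutativeMonoid
  renaming (sum to ∏; sum-cong-≗ to ∏-cong; ∑-distrib-+ to ∏-distrib-*)
  using ()

private variable
  n : ℕ

-- Finite sums and products

ι : Bool → ℕ
ι b = if b then 1 else 0

==-refl : (x : Fin n) → (x == x) ≡ true
==-refl x with x Fin.≟ x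
... | yes _ = refl
... | no ¬p = contradiction refl ¬p

≢⇒== : {x y : Fin n} → x ≢ y → (x == y) ≡ false
≢⇒== {x = x} {y} x≢y with x Fin.≟ y
... | yes p = contradiction p x≢y
... | no _  = refl

==⇒≡ : {x y : Fin n} → (x == y) ≡ true → x ≡ y
==⇒≡ {x = x} {y} p with x Fin.≟ y
... | yes q = q

sum-allFin : (f : Fin n → ℕ) → sum (map f (allFin n)) ≡ ∑ f
sum-allFin {n} f = trans (cong sum (map-tabulate id f)) (go f)
  where
  go : ∀ {m} (g : Fin m → ℕ) → sum (List.tabulate g) ≡ ∑ g
  go {zero}  g = refl
  go {suc m} g = cong (g zero +_) (go (g ∘ suc))

product-allFin : (f : Fin n → ℕ) → product (map f (allFin n)) ≡ ∏ f
product-allFin {n} f = trans (cong product (map-tabulate id f)) (go f)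
  where
  go : ∀ {m} (g : Fin m → ℕ) → product (List.tabulate g) ≡ ∏ g
  go {zero}  g = refl
  go {suc m} g = cong (g zero *_) (go (g ∘ suc))

∑-mono : {f g : Fin n → ℕ} → (∀ x → f x ≤ g x) → ∑ f ≤ ∑ g
∑-mono {zero}  f≤g = z≤n
∑-mono {suc n} f≤g = +-mono-≤ (f≤g zero) (∑-mono (f≤g ∘ suc))

∏-mono : {f g : Fin n → ℕ} → (∀ x → f x ≤ g x) → ∏ f ≤ ∏ g
∏-mono {zero}  f≤g = ≤-refl
∏-mono {suc n} f≤g = *-mono-≤ (f≤g zero) (∏-mono (f≤g ∘ suc))

∑-*ʳ : (f : Fin n → ℕ) (c : ℕ) → ∑ (λ x → f x * c) ≡ ∑ f * c
∑-*ʳ {zero}  f c = refl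
∑-*ʳ {suc n} f c = trans (cong (f zero * c +_) (∑-*ʳ (f ∘ suc) c)) (sym (*-distribʳ-+ c (f zero) _))

∑-one : ∀ n → ∑ {n} (λ _ → 1) ≡ n
∑-one zero    = refl
∑-one (suc n) = cong suc (∑-one n)

∑-zero : {f : Fin n → ℕ} → (∀ x → f x ≡ 0) → ∑ f ≡ 0
∑-zero {zero}  f≡0 = refl
∑-zero {suc n} f≡0 = cong₂ _+_ (f≡0 zero) (∑-zero (f≡0 ∘ suc))

∏-one : {f : Fin n → ℕ} → (∀ x → f x ≡ 1) → ∏ f ≡ 1
∏-one {zero}  f≡1 = refl
∏-one {suc n} f≡1 = cong₂ _*_ (f≡1 zero) (∏-one (f≡1 ∘ suc))

∏≥1 : {f : Fin n → ℕ} → (∀ x → 1 ≤ f x) → 1 ≤ ∏ f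
∏≥1 {zero}  1≤f = ≤-refl
∏≥1 {suc n} 1≤f = *-mono-≤ (1≤f zero) (∏≥1 (1≤f ∘ suc))

suc-== : (x y : Fin n) → (suc x == suc y) ≡ (x == y)
suc-== x y with x Fin.≟ y
... | yes _ = refl
... | no _  = refl

∑-δ : (a : Fin n) → ∑ (λ x → ι (x == a)) ≡ 1
∑-δ {suc n} zero    = cong suc (∑-zero {n} λ x → refl)
∑-δ (suc a) = trans (∑-cong λ x → cong ι (suc-== x a)) (∑-δ a)

-- A strict inequality in one term would survive in the sum. This turns the edge count of a tree
-- into statements about single vertices and single edges.
∑-tight : {f g : Fin n → ℕ} → (∀ x → f x ≤ g x) → ∑ g ≤ ∑ f → ∀ x → f x ≡ g x
∑-tight {suc n} {f} {g} f≤g ∑g≤∑f zero = ≤-antisym (f≤g zero)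
  (+-cancelʳ-≤ (∑ (g ∘ suc)) _ _ (≤-trans ∑g≤∑f (+-monoʳ-≤ (f zero) (∑-mono (f≤g ∘ suc)))))
∑-tight {suc n} {f} {g} f≤g ∑g≤∑f (suc x) = ∑-tight (f≤g ∘ suc)
  (+-cancelˡ-≤ (g zero) _ _ (≤-trans ∑g≤∑f (+-monoˡ-≤ _ (f≤g zero)))) x

except : Fin n → (Fin n → ℕ) → Fin n → ℕ
except a f y = if y == a then 1 else f y

except-≢ : ∀ {a y : Fin n} f → y ≢ a → except a f y ≡ f y
except-≢ f y≢a = cong (if_then 1 else f _) (≢⇒== y≢a)

∏-extract : (f : Fin n → ℕ) (a : Fin n) → ∏ f ≡ f a * ∏ (except a f)
∏-extract f zero = cong (f zero *_) (sym (*-identityˡ (∏ (f ∘ suc))))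
∏-extract f (suc a) = begin
  f zero * ∏ (f ∘ suc)
    ≡⟨ cong (f zero *_) (∏-extract (f ∘ suc) a) ⟩
  f zero * (f (suc a) * ∏ (except a (f ∘ suc)))
    ≡⟨ swap (f zero) (f (suc a)) _ ⟩
  f (suc a) * (f zero * ∏ (except a (f ∘ suc)))
    ≡⟨ cong (λ t → f (suc a) * (f zero * t)) (∏-cong λ y → cong (if_then 1 else f (suc y)) (sym (suc-== y a))) ⟩
  f (suc a) * ∏ (except (suc a) f) ∎
  where
  open ≡-Reasoning
  swap : ∀ x y z → x * (y * z) ≡ y * (x * z)
  swap = solve-∀

except≥1 : {f : Fin n → ℕ} (a : Fin n) → (∀ x → 1 ≤ f x) → ∀ x → 1 ≤ except a f x
except≥1 a 1≤f x with x == a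
... | true  = ≤-refl
... | false = 1≤f x

factor≤∏ : {f : Fin n → ℕ} (a : Fin n) → (∀ x → 1 ≤ f x) → f a ≤ ∏ f
factor≤∏ {f = f} a 1≤f = begin
  f a                    ≡⟨ *-identityʳ (f a) ⟨
  f a * 1                ≤⟨ *-monoʳ-≤ (f a) (∏≥1 (except≥1 a 1≤f)) ⟩
  f a * ∏ (except a f)   ≡⟨ ∏-extract f a ⟨
  ∏ f                    ∎
  where open ≤-Reasoning

count≡∑ : (p : Fin n → Bool) → count p ≡ ∑ (ι ∘ p)
count≡∑ p = sum-allFin (ι ∘ p)

true⇒1≤count : (p : Fin n → Bool) {a : Fin n} → p a ≡ true → 1 ≤ count p
true⇒1≤count p {a} pa = subst₂ _≤_ (∑-δ a) (sym (count≡∑ p)) (∑-mono pointwise)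
  where
  pointwise : ∀ x → ι (x == a) ≤ ι (p x)
  pointwise x with x Fin.≟ a
  ... | yes refl rewrite pa = ≤-refl
  ... | no _ = z≤n

count≤1⇒≡ : (p : Fin n → Bool) → count p ≤ 1 → ∀ {a b} → p a ≡ true → p b ≡ true → a ≡ b
count≤1⇒≡ p c≤1 {a} {b} pa pb with a Fin.≟ b
... | yes a≡b = a≡b
... | no a≢b  = contradiction (≤-trans 2≤ c≤1) λ { (s≤s ()) }
  where
  pointwise : ∀ x → ι (x == a) + ι (x == b) ≤ ι (p x)
  pointwise x with x Fin.≟ a | x Fin.≟ b
  ... | yes refl | yes refl = contradiction refl a≢b
  ... | yes refl | no _  rewrite pa = ≤-refl
  ... | no _  | yes refl rewrite pb = ≤-refl
  ... | no _  | no _  = z≤n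
  2≤ : 2 ≤ count p
  2≤ = subst₂ _≤_ (trans (∑-distrib-+ (λ x → ι (x == a)) _) (cong₂ _+_ (∑-δ a) (∑-δ b)))
    (sym (count≡∑ p)) (∑-mono pointwise)

maxOver-upper : (f : Fin n → ℕ) (a : Fin n) → f a ≤ maxOver f
maxOver-upper {n} f a = subst (λ xs → f a ≤ foldr _⊔_ 0 xs) (sym (map-tabulate id f)) (go f a)
  where
  go : ∀ {m} (g : Fin m → ℕ) a → g a ≤ foldr _⊔_ 0 (List.tabulate g)
  go g zero    = m≤m⊔n _ _
  go g (suc a) = ≤-trans (go (g ∘ suc) a) (m≤n⊔m (g zero) _)

maxOver-least : (f : Fin n → ℕ) {b : ℕ} → (∀ x → f x ≤ b) → maxOver f ≤ b
maxOver-least {n} f {b} f≤b = subst (λ xs → foldr _⊔_ 0 xs ≤ b) (sym (map-tabulate id f)) (go f f≤b)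
  where
  go : ∀ {m} (g : Fin m → ℕ) → (∀ x → g x ≤ b) → foldr _⊔_ 0 (List.tabulate g) ≤ b
  go {zero}  g g≤b = z≤n
  go {suc m} g g≤b = ⊔-lub (g≤b zero) (go (g ∘ suc) (g≤b ∘ suc))

any-true⁺ : (p : Fin n → Bool) {a : Fin n} → p a ≡ true → any p (allFin n) ≡ true
any-true⁺ p {a} pa = Equivalence.to T-≡
  (any⁺ p (lose (∈-allFin a) (Equivalence.from T-≡ pa)))

any-true⁻ : (p : Fin n → Bool) → any p (allFin n) ≡ true → ∃ λ a → p a ≡ true
any-true⁻ p q with satisfied (any⁻ p (allFin _) (Equivalence.from T-≡ q))
... | a , pa = a , Equivalence.to T-≡ pa

-- Distances

∨-true⁻ : ∀ a {b} → a ∨ b ≡ true → a ≡ true ⊎ b ≡ true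
∨-true⁻ true  _ = inj₁ refl
∨-true⁻ false p = inj₂ p

∧-true⁻ : ∀ a {b} → a ∧ b ≡ true → a ≡ true × b ≡ true
∧-true⁻ true p = refl , p

∨-true⁺ʳ : ∀ a {b} → b ≡ true → a ∨ b ≡ true
∨-true⁺ʳ true  _ = refl
∨-true⁺ʳ false p = p

firstTrue-spec : ∀ p f → p (firstTrue p f) ≡ true ⊎ firstTrue p f ≡ f
firstTrue-spec p zero = inj₂ refl
firstTrue-spec p (suc f) with p 0 in eq
... | true = inj₁ eq
... | false with firstTrue-spec (p ∘ suc) f
...   | inj₁ q = inj₁ q
...   | inj₂ q = inj₂ (cong suc q)

firstTrue-min : ∀ p f {k} → p k ≡ true → firstTrue p f ≤ k
firstTrue-min p zero pk = z≤n
firstTrue-min p (suc f) {k} pk with p 0 in eq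
... | true = z≤n
firstTrue-min p (suc f) {zero} pk | false = contradiction (trans (sym eq) pk) λ ()
firstTrue-min p (suc f) {suc k} pk | false = s≤s (firstTrue-min (p ∘ suc) f pk)

firstTrue≤fuel : ∀ p f → firstTrue p f ≤ f
firstTrue≤fuel p zero = z≤n
firstTrue≤fuel p (suc f) with p 0
... | true  = z≤n
... | false = s≤s (firstTrue≤fuel (p ∘ suc) f)

-- Such functions bound distances from below, by induction along a walk; distances in the new tree
-- enter the proof only through bounds of this kind.
Lipschitz : Graph n → (Fin n → ℕ) → Set
Lipschitz G φ = ∀ x y → G x y ≡ true → φ x ≤ suc (φ y)

reach-lipschitz : (G : Graph n) {φ : Fin n → ℕ} → Lipschitz G φ →
  ∀ u k {y} → reach G u k y ≡ true → φ u ≤ φ y + k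
reach-lipschitz G {φ} lip u zero {y} r =
  ≤-reflexive (trans (cong φ (sym (==⇒≡ r))) (sym (+-identityʳ (φ y))))
reach-lipschitz {n} G {φ} lip u (suc k) {y} r with ∨-true⁻ (reach G u k y) r
... | inj₁ r′ = ≤-trans (reach-lipschitz G lip u k r′) (+-monoʳ-≤ (φ y) (n≤1+n k))
... | inj₂ s with any-true⁻ (λ x → reach G u k x ∧ G x y) s
...   | x , rg with ∧-true⁻ (reach G u k x) rg
...     | r′ , g = ≤-trans (reach-lipschitz G lip u k r′)
            (≤-trans (+-monoˡ-≤ k (lip x y g)) (≤-reflexive (sym (+-suc (φ y) k))))

dist≤n : (G : Graph n) → ∀ x y → dist G x y ≤ n
dist≤n G x y = firstTrue≤fuel _ _

-- In a disconnected graph dist is capped at n, whence the hypothesis m ≤ n.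
lipschitz⇒≤dist : (G : Graph n) {φ : Fin n → ℕ} → Lipschitz G φ →
  ∀ {x y m} → φ y ≡ 0 → m ≤ φ x → m ≤ n → m ≤ dist G x y
lipschitz⇒≤dist {n} G lip {x} {y} {m} φy≡0 m≤φx m≤n with firstTrue-spec (λ k → reach G x k y) n
... | inj₂ eq = ≤-trans m≤n (≤-reflexive (sym eq))
... | inj₁ r  = ≤-trans m≤φx (≤-trans (reach-lipschitz G lip x _ r) (≤-reflexive (cong (_+ dist G x y) φy≡0)))

dist≤ecc : (G : Graph n) → ∀ x y → dist G x y ≤ ecc G x
dist≤ecc G x y = maxOver-upper (dist G x) y

ecc≤diam : (G : Graph n) → ∀ x → ecc G x ≤ diam G
ecc≤diam G x = maxOver-upper (ecc G) x

dist≤diam : (G : Graph n) → ∀ x y → dist G x y ≤ diam G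
dist≤diam G x y = ≤-trans (dist≤ecc G x y) (ecc≤diam G x)

module Distance {n} (G : Graph n) (G-sym : Symmetric G) (G-conn : Connected G) where

  d : Fin n → Fin n → ℕ
  d = dist G

  swap-edge : ∀ {x y} → G x y ≡ true → G y x ≡ true
  swap-edge {x} {y} g = trans (G-sym y x) g

  reach-dist : ∀ u v → reach G u (d u v) v ≡ true
  reach-dist u v with firstTrue-spec (λ k → reach G u k v) n
  ... | inj₁ r  = r
  ... | inj₂ eq = subst (λ k → reach G u k v ≡ true) (sym eq) (G-conn u v)

  dist-min : ∀ {u v k} → reach G u k v ≡ true → d u v ≤ k
  dist-min r = firstTrue-min _ n r

  dist-refl : ∀ x → d x x ≡ 0
  dist-refl x = n≤0⇒n≡0 (dist-min {x} {x} {0} (==-refl x))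

  dist≡0⇒≡ : ∀ {x y} → d x y ≡ 0 → x ≡ y
  dist≡0⇒≡ {x} {y} eq = sym (==⇒≡ (subst (λ k → reach G x k y ≡ true) eq (reach-dist x y)))

  dist-step : ∀ u {x y} → G x y ≡ true → d u y ≤ suc (d u x)
  dist-step u {x} {y} g = dist-min (∨-true⁺ʳ (reach G u (d u x) y)
    (any-true⁺ (λ z → reach G u (d u x) z ∧ G z y) (cong₂ _∧_ (reach-dist u x) g)))

  dist-lipschitz : ∀ u → Lipschitz G (d u)
  dist-lipschitz u x y g = dist-step u (swap-edge g)

  -- The last summand is `d x y` and not `d y x` because the symmetry of `d` is derived from this
  -- inequality.
  triangle : ∀ z x y → d z x ≤ d z y + d x y
  triangle z x y = reach-lipschitz G (dist-lipschitz z) x _ (reach-dist x y)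

  dist-sym-≤ : ∀ x y → d y x ≤ d x y
  dist-sym-≤ x y = ≤-trans (triangle y x y) (≤-reflexive (cong (_+ d x y) (dist-refl y)))

  dist-sym : ∀ x y → d x y ≡ d y x
  dist-sym x y = ≤-antisym (dist-sym-≤ y x) (dist-sym-≤ x y)

  -- The witness is the last vertex but one of a shortest walk from `u` to `v`.
  closer-neighbour : ∀ u v → v ≢ u → ∃ λ x → G v x ≡ true × suc (d u x) ≡ d u v
  closer-neighbour u v v≢u with d u v in eq
  ... | zero = contradiction (sym (dist≡0⇒≡ eq)) v≢u
  ... | suc m with ∨-true⁻ (reach G u m v) (subst (λ k → reach G u k v ≡ true) eq (reach-dist u v))
  ...   | inj₁ r = contradiction (≤-trans (≤-reflexive (sym eq)) (dist-min r)) 1+n≰n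
  ...   | inj₂ s with any-true⁻ (λ x → reach G u m x ∧ G x v) s
  ...     | x , rg with ∧-true⁻ (reach G u m x) rg
  ...       | r , g = x , swap-edge g , ≤-antisym (s≤s (dist-min r))
                (≤-trans (≤-reflexive (sym eq)) (dist-step u g))

  dist-edge : ∀ {x y} → G x y ≡ true → d x y ≤ 1
  dist-edge {x} g = ≤-trans (dist-step x g) (≤-reflexive (cong suc (dist-refl x)))

-- Trees

module Tree {n} (G : Graph n) (tree : IsTree G) where

  G-sym : Symmetric G
  G-sym = proj₁ tree

  G-irrefl : Irreflexive G
  G-irrefl = proj₁ (proj₂ tree)

  open Distance G G-sym (proj₁ (proj₂ (proj₂ tree))) public

  private
    closer : Fin n → Fin n → Fin n → Bool
    closer r x y = G x y ∧ ⌊ d r y <? d r x ⌋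

    closer⁺ : ∀ {r x y} → G x y ≡ true → d r y < d r x → closer r x y ≡ true
    closer⁺ {r} {x} {y} g lt rewrite g with d r y <? d r x
    ... | yes _  = refl
    ... | no ¬lt = contradiction lt ¬lt

    closer⁻ : ∀ {r x y} → closer r x y ≡ true → d r y < d r x
    closer⁻ {r} {x} {y} c with G x y | d r y <? d r x
    ... | true | yes lt = lt

    closer-antisym : ∀ r x y → ι (closer r x y) + ι (closer r y x) ≤ ι (G x y)
    closer-antisym r x y rewrite G-sym y x with G x y
    ... | false = z≤n
    ... | true with d r y <? d r x | d r x <? d r y
    ...   | yes p | yes q = contradiction q (<-asym p)
    ...   | yes p | no _  = ≤-refl
    ...   | no _  | yes _ = ≤-refl
    ...   | no _  | no _  = z≤n

    closer-exists : ∀ r x → ι (not (x == r)) ≤ ∑ (λ y → ι (closer r x y))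
    closer-exists r x with x Fin.≟ r
    ... | yes _ = z≤n
    ... | no x≢r with closer-neighbour r x x≢r
    ...   | y , g , eq = subst (1 ≤_) (count≡∑ (closer r x))
            (true⇒1≤count (closer r x) (closer⁺ {r} {x} {y} g (≤-reflexive eq)))

    ∑-non-root : ∀ (r : Fin n) → ∑ (λ x → ι (not (x == r))) ≡ n ∸ 1
    ∑-non-root r = sym (trans (cong (_∸ 1) (sym split)) (m+n∸n≡m _ 1))
      where
      pointwise : ∀ x → ι (not (x == r)) + ι (x == r) ≡ 1
      pointwise x with x == r
      ... | true  = refl
      ... | false = refl
      split : ∑ (λ x → ι (not (x == r))) + 1 ≡ n
      split = begin
        ∑ (λ x → ι (not (x == r))) + 1
          ≡⟨ cong (∑ (λ x → ι (not (x == r))) +_) (∑-δ r) ⟨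
        ∑ (λ x → ι (not (x == r))) + ∑ (λ x → ι (x == r))
          ≡⟨ ∑-distrib-+ (λ x → ι (not (x == r))) (λ x → ι (x == r)) ⟨
        ∑ (λ x → ι (not (x == r)) + ι (x == r))  ≡⟨ ∑-cong pointwise ⟩
        ∑ {n} (λ _ → 1)                          ≡⟨ ∑-one n ⟩
        n                                        ∎
        where open ≡-Reasoning

    -- The pairs (x, y) with y adjacent to x and closer to r: at least one for each x ≢ r, and at most
    -- one for each of the n ∸ 1 edges.  Hence exactly one for each, which gives the tree structure.
    closerPairs : Fin n → ℕ
    closerPairs r = ∑ λ x → ∑ λ y → ι (closer r x y)

    nearer+farther : Fin n → Fin n → ℕ
    nearer+farther r x = ∑ λ y → ι (closer r x y) + ι (closer r y x)

    ∑-nearer+farther : ∀ r → ∑ (nearer+farther r) ≡ closerPairs r + closerPairs r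
    ∑-nearer+farther r = begin
      ∑ (nearer+farther r)
        ≡⟨ ∑-cong (λ x → ∑-distrib-+ (λ y → ι (closer r x y)) (λ y → ι (closer r y x))) ⟩
      ∑ (λ x → ∑ (λ y → ι (closer r x y)) + ∑ (λ y → ι (closer r y x)))
        ≡⟨ ∑-distrib-+ (λ x → ∑ (λ y → ι (closer r x y))) _ ⟩
      closerPairs r + ∑ (λ x → ∑ (λ y → ι (closer r y x)))
        ≡⟨ cong (closerPairs r +_) (∑-comm (λ x y → ι (closer r y x))) ⟩
      closerPairs r + closerPairs r ∎
      where open ≡-Reasoning

    nearer+farther≤deg : ∀ r x → nearer+farther r x ≤ ∑ (λ y → ι (G x y))
    nearer+farther≤deg r x = ∑-mono (closer-antisym r x)

    ∑-deg : ∑ (λ x → ∑ (λ y → ι (G x y))) ≡ (n ∸ 1) + (n ∸ 1)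
    ∑-deg = begin
      ∑ (λ x → ∑ (λ y → ι (G x y)))  ≡⟨ ∑-cong (λ x → count≡∑ (G x)) ⟨
      ∑ (deg G)                      ≡⟨ sum-allFin (deg G) ⟨
      orderedEdges G                 ≡⟨ proj₂ (proj₂ (proj₂ tree)) ⟩
      2 * (n ∸ 1)                    ≡⟨ cong ((n ∸ 1) +_) (+-identityʳ (n ∸ 1)) ⟩
      (n ∸ 1) + (n ∸ 1)              ∎
      where open ≡-Reasoning

    closerPairs≥ : ∀ r → n ∸ 1 ≤ closerPairs r
    closerPairs≥ r = subst (_≤ closerPairs r) (∑-non-root r) (∑-mono (closer-exists r))

    -- Each pair and its reversal are two ordered adjacent pairs, and a tree has only twice `n ∸ 1`
    -- of these.
    closerPairs≤ : ∀ r → closerPairs r ≤ n ∸ 1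
    closerPairs≤ r = ≮⇒≥ λ lt → <⇒≱ (+-mono-< lt lt)
      (subst₂ _≤_ (∑-nearer+farther r) ∑-deg (∑-mono (nearer+farther≤deg r)))

    closer-count : ∀ r x → ι (not (x == r)) ≡ ∑ (λ y → ι (closer r x y))
    closer-count r = ∑-tight (closer-exists r)
      (≤-trans (closerPairs≤ r) (≤-reflexive (sym (∑-non-root r))))

    closer-count≤1 : ∀ r x → count (closer r x) ≤ 1
    closer-count≤1 r x = subst (_≤ 1) (trans (closer-count r x) (sym (count≡∑ (closer r x)))) (bound (not (x == r)))
      where
      bound : ∀ b → ι b ≤ 1
      bound true  = ≤-refl
      bound false = z≤n

    -- Equality of the totals is pushed down twice by `∑-tight`, first to the vertex `x` and then to
    -- the single pair: no edge joins two vertices at the same distance from `r`.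
    edge-oriented : ∀ r x y → ι (closer r x y) + ι (closer r y x) ≡ ι (G x y)
    edge-oriented r x = ∑-tight (closer-antisym r x) (≤-reflexive (sym
      (∑-tight (nearer+farther≤deg r)
        (≤-trans (≤-reflexive ∑-deg)
          (≤-trans (+-mono-≤ (closerPairs≥ r) (closerPairs≥ r)) (≤-reflexive (sym (∑-nearer+farther r)))))
        x)))

  closer-or-farther : ∀ r {x y} → G x y ≡ true → d r x ≡ suc (d r y) ⊎ d r y ≡ suc (d r x)
  closer-or-farther r {x} {y} g with closer r x y in p | closer r y x in q | edge-oriented r x y
  ... | true  | _     | _  = inj₁ (≤-antisym (dist-lipschitz r x y g) (closer⁻ {r} {x} {y} p))
  ... | false | true  | _  = inj₂ (≤-antisym (dist-step r g) (closer⁻ {r} {y} {x} q))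
  ... | false | false | eq = contradiction (trans eq (cong ι g)) λ ()

  closer-unique : ∀ r {x y z} → G x y ≡ true → G x z ≡ true → d r y < d r x → d r z < d r x → y ≡ z
  closer-unique r {x} {y} {z} gy gz ly lz =
    count≤1⇒≡ (closer r x) (closer-count≤1 r x) (closer⁺ {r} {x} {y} gy ly) (closer⁺ {r} {x} {z} gz lz)

  -- At most one neighbour is closer to `r`, and here every neighbour is. Applied to the ends of
  -- diametric paths, which are therefore leaves.
  all-closer⇒deg≤1 : ∀ r {x} → (∀ y → G x y ≡ true → d r y < d r x) → deg G x ≤ 1
  all-closer⇒deg≤1 r {x} h = ≤-trans
    (subst₂ _≤_ (sym (count≡∑ (G x))) (sym (count≡∑ (closer r x))) (∑-mono pointwise)) (closer-count≤1 r x)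
    where
    pointwise : ∀ y → ι (G x y) ≤ ι (closer r x y)
    pointwise y with G x y in g
    ... | false = z≤n
    ... | true with d r y <? d r x
    ...   | yes _ = ≤-refl
    ...   | no ¬p = contradiction (h y g) ¬p

  diametric-end⇒deg≤1 : ∀ {r x} → d r x ≡ diam G → deg G x ≤ 1
  diametric-end⇒deg≤1 {r} {x} eq = all-closer⇒deg≤1 r λ y g → case-edge y (closer-or-farther r g)
    where
    case-edge : ∀ y → d r x ≡ suc (d r y) ⊎ d r y ≡ suc (d r x) → d r y < d r x
    case-edge y (inj₁ p) = ≤-reflexive (sym p)
    case-edge y (inj₂ p) = contradiction
      (≤-trans (≤-reflexive (trans (cong suc (sym eq)) (sym p))) (dist≤diam G r y)) 1+n≰n

  -- Only one neighbour of `x` can be closer to `r`, and `y` already is.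
  step-away : ∀ r {x y z} → G x y ≡ true → G x z ≡ true → y ≢ z → d r y < d r x → d r z ≡ suc (d r x)
  step-away r gy gz y≢z ly with closer-or-farther r gz
  ... | inj₂ p = p
  ... | inj₁ p = contradiction (closer-unique r gy gz ly (≤-reflexive (sym p))) y≢z

  -- A walk that starts by moving away from c and towards b never turns back.
  dist-through-edge : ∀ m {c b x y} → G x y ≡ true → d c y ≡ suc (d c x) → d b x ≡ suc (d b y) →
    d b y ≡ m → d c b ≡ d c x + d b x
  dist-through-edge zero {c} {b} {x} {y} g cy bx by = begin
    d c b            ≡⟨ cong (d c) (dist≡0⇒≡ by) ⟩
    d c y            ≡⟨ cy ⟩
    suc (d c x)      ≡⟨ +-comm 1 (d c x) ⟩
    d c x + 1        ≡⟨ cong (λ t → d c x + suc t) by ⟨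
    d c x + suc (d b y) ≡⟨ cong (d c x +_) bx ⟨
    d c x + d b x    ∎
    where open ≡-Reasoning
  dist-through-edge (suc m) {c} {b} {x} {y} g cy bx by with closer-neighbour b y
    (λ { refl → contradiction (trans (sym (dist-refl y)) by) λ () })
  ... | z , gz , eq = begin
    d c b                 ≡⟨ dist-through-edge m gz (step-away c (swap-edge g) gz x≢z (≤-reflexive (sym cy)))
                               (sym eq) (suc-injective (trans eq by)) ⟩
    d c y + d b y         ≡⟨ cong (_+ d b y) cy ⟩
    suc (d c x) + d b y   ≡⟨ +-suc (d c x) (d b y) ⟨
    d c x + suc (d b y)   ≡⟨ cong (d c x +_) bx ⟨
    d c x + d b x         ∎
    where
    open ≡-Reasoning
    x≢z : x ≢ z
    x≢z refl = <-asym (≤-reflexive eq) (≤-reflexive (sym bx))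

  private
    -- The hypotheses on the edge put `a` on the path from `c` to `b`; what remains is the triangle
    -- inequality for `c`, `a` and `e`.
    four-point-through : ∀ {N a a′ b c e} → G a a′ ≡ true → d c a′ ≡ suc (d c a) → d b a ≡ suc (d b a′) →
      d a e + d b c ≤ N → d a b + d c e ≤ N
    four-point-through {N} {a} {a′} {b} {c} {e} g ca′ ba le = begin
      d a b + d c e             ≤⟨ +-monoʳ-≤ (d a b) (triangle c e a) ⟩
      d a b + (d c a + d e a)   ≡⟨ +-assoc (d a b) _ _ ⟨
      (d a b + d c a) + d e a   ≡⟨ cong₂ _+_ (trans (+-comm (d a b) (d c a)) (cong (d c a +_) (dist-sym a b))) (dist-sym e a) ⟩
      (d c a + d b a) + d a e   ≡⟨ cong (_+ d a e) (dist-through-edge (d b a′) g ca′ ba refl) ⟨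
      d c b + d a e             ≡⟨ trans (+-comm (d c b) (d a e)) (cong (d a e +_) (dist-sym c b)) ⟩
      d a e + d b c             ≤⟨ le ⟩
      N                         ∎
      where open ≤-Reasoning

  -- Induction on the distance from `a` to `b`, moving `a` one step to `a′` towards `b`. If the step
  -- leads away from `c` or from `e`, then `a` lies on the path from there to `b` and
  -- `four-point-through` applies. Otherwise the distances from `a` to all three drop by one, and
  -- the bound `N` drops with them.
  four-point : ∀ m a b c e N → d b a ≡ m → d a c + d b e ≤ N → d a e + d b c ≤ N → d a b + d c e ≤ N
  four-point zero a b c e N eq l₁ l₂ with dist≡0⇒≡ eq
  ... | refl = begin
    d b b + d c e  ≡⟨ cong (_+ d c e) (dist-refl b) ⟩
    d c e          ≤⟨ triangle c e b ⟩
    d c b + d e b  ≡⟨ cong₂ _+_ (dist-sym c b) (dist-sym e b) ⟩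
    d b c + d b e  ≤⟨ l₁ ⟩
    N              ∎
    where open ≤-Reasoning
  four-point (suc m) a b c e N eq l₁ l₂ with closer-neighbour b a
    (λ { refl → contradiction (trans (sym (dist-refl a)) eq) λ () })
  ... | a′ , g , ba with closer-or-farther c g
  ... | inj₂ ca′ = four-point-through g ca′ (sym ba) l₂
  ... | inj₁ ca with closer-or-farther e g
  ... | inj₂ ea′ = subst (λ t → d a b + t ≤ N) (dist-sym e c) (four-point-through g ea′ (sym ba) l₁)
  ... | inj₁ ea = shift N (subst (λ t → t + d b e ≤ N) ac l₁) (subst (λ t → t + d b c ≤ N) ae l₂)
    where
    ac : d a c ≡ suc (d a′ c)
    ac = trans (dist-sym a c) (trans ca (cong suc (dist-sym c a′)))
    ae : d a e ≡ suc (d a′ e)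
    ae = trans (dist-sym a e) (trans ea (cong suc (dist-sym e a′)))
    ab : d a b ≡ suc (d a′ b)
    ab = trans (dist-sym a b) (trans (sym ba) (cong suc (dist-sym b a′)))
    shift : ∀ N → suc (d a′ c) + d b e ≤ N → suc (d a′ e) + d b c ≤ N → d a b + d c e ≤ N
    shift (suc N) (s≤s l₁) (s≤s l₂) = subst (λ t → t + d c e ≤ suc N) (sym ab)
      (s≤s (four-point m a′ b c e N (suc-injective (trans ba eq)) l₁ l₂))

  -- Apply `four-point` with the ends `r` and `s` as `c` and `e`: both other pairings of distances
  -- are at most `m + diam G`, and `d r s` cancels.
  ecc≤-from-ends : ∀ {r s} → d r s ≡ diam G → ∀ x {m} → d x r ≤ m → d x s ≤ m → ecc G x ≤ m
  ecc≤-from-ends {r} {s} rs x {m} xr xs = maxOver-least (d x) λ y →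
    +-cancelʳ-≤ (diam G) _ _ (subst (λ t → d x y + t ≤ m + diam G) rs
      (four-point _ x y r s (m + diam G) refl
        (+-mono-≤ xr (dist≤diam G y s)) (+-mono-≤ xs (dist≤diam G y r))))

-- Moving branches along a diametric path

inW⁻ : ∀ {n k} (W : Fin k → Fin n) {x} → inW W x ≡ true → ∃ λ a → W a ≡ x
inW⁻ W p with any-true⁻ _ p
... | a , q = a , ==⇒≡ q

inW⁺ : ∀ {n k} (W : Fin k → Fin n) a → inW W (W a) ≡ true
inW⁺ W a = any-true⁺ (λ b → W b == W a) (==-refl (W a))

-- Diametric paths in a tree

module DiametricPath {n} (G : Graph n) (tree : IsTree G) (P : ℕ → Fin n) (diametric : Diametric G P) where

  open Tree G tree public

  D : ℕ
  D = diam G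

  v₀ v_D : Fin n
  v₀  = P 0
  v_D = P D

  path-edge : ∀ {m} → m < D → G (P m) (P (suc m)) ≡ true
  path-edge = proj₁ diametric _

  ends : d v₀ v_D ≡ D
  ends = proj₂ diametric

  private
    dist-start≤ : ∀ m → m ≤ D → d v₀ (P m) ≤ m
    dist-start≤ zero    m≤D = ≤-reflexive (dist-refl v₀)
    dist-start≤ (suc m) m<D = ≤-trans (dist-step v₀ (path-edge m<D)) (s≤s (dist-start≤ m (<⇒≤ m<D)))

    dist-end≤ : ∀ l m → m + l ≡ D → d v_D (P m) ≤ l
    dist-end≤ zero m eq = ≤-reflexive (trans (cong (d v_D ∘ P) (trans (sym (+-identityʳ m)) eq)) (dist-refl v_D))
    dist-end≤ (suc l) m eq = ≤-trans (dist-lipschitz v_D _ _ (path-edge m<D)) (s≤s (dist-end≤ l (suc m) eq′))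
      where
      eq′ : suc m + l ≡ D
      eq′ = trans (sym (+-suc m l)) eq
      m<D : m < D
      m<D = ≤-trans (m≤m+n (suc m) l) (≤-reflexive eq′)

    dist-ends-via : ∀ m → D ≤ d v₀ (P m) + d v_D (P m)
    dist-ends-via m = subst (_≤ d v₀ (P m) + d v_D (P m)) ends (triangle v₀ v_D (P m))

  -- The path bounds this distance by `m` and the distance to `v_D` by `D ∸ m`; since the ends are
  -- `D` apart, both bounds are attained.
  dist-start : ∀ {m} → m ≤ D → d v₀ (P m) ≡ m
  dist-start {m} m≤D = ≤-antisym (dist-start≤ m m≤D)
    (+-cancelʳ-≤ (D ∸ m) _ _ (≤-trans (≤-reflexive (m+[n∸m]≡n m≤D))
      (≤-trans (dist-ends-via m) (+-monoʳ-≤ _ (dist-end≤ (D ∸ m) m (m+[n∸m]≡n m≤D))))))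

  dist-end : ∀ {m} → m ≤ D → d v_D (P m) ≡ D ∸ m
  dist-end {m} m≤D = ≤-antisym (dist-end≤ (D ∸ m) m (m+[n∸m]≡n m≤D))
    (m≤n+o⇒m∸n≤o D m (≤-trans (dist-ends-via m) (+-monoˡ-≤ _ (dist-start≤ m m≤D))))

  P-injective : ∀ {a b} → a ≤ D → b ≤ D → P a ≡ P b → a ≡ b
  P-injective a≤D b≤D eq = trans (sym (dist-start a≤D)) (trans (cong (d v₀) eq) (dist-start b≤D))

  path-adjacent : ∀ {a b} → a ≤ D → b ≤ D → G (P a) (P b) ≡ true → a ≡ suc b ⊎ b ≡ suc a
  path-adjacent a≤D b≤D g with closer-or-farther v₀ g
  ... | inj₁ p = inj₁ (trans (sym (dist-start a≤D)) (trans p (cong suc (dist-start b≤D))))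
  ... | inj₂ p = inj₂ (trans (sym (dist-start b≤D)) (trans p (cong suc (dist-start a≤D))))

  deg-interior : ∀ {m} → suc m < D → 2 ≤ deg G (P (suc m))
  deg-interior {m} m<D = ≮⇒≥ λ lt → contradiction
    (P-injective (≤-trans (n≤1+n m) (<⇒≤ m<D)) m<D
      (count≤1⇒≡ (G (P (suc m))) (s≤s⁻¹ lt) (swap-edge (path-edge (<⇒≤ m<D))) (path-edge m<D)))
    (<⇒≢ (s≤s (n≤1+n m)))

  non-adjacent : ∀ {a b} → a ≤ D → b ≤ D → a ≢ suc b → b ≢ suc a → G (P a) (P b) ≡ false
  non-adjacent a≤D b≤D a≢ b≢ = ¬-not λ g → contradiction (path-adjacent a≤D b≤D g) λ
    { (inj₁ eq) → a≢ eq ; (inj₂ eq) → b≢ eq }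

  P≢P : ∀ {a b} → a ≤ D → b ≤ D → a ≢ b → P a ≢ P b
  P≢P a≤D b≤D a≢b eq = a≢b (P-injective a≤D b≤D eq)

  deg-v₀≤1 : deg G v₀ ≤ 1
  deg-v₀≤1 = diametric-end⇒deg≤1 (trans (dist-sym v_D v₀) ends)

  deg-v_D≤1 : deg G v_D ≤ 1
  deg-v_D≤1 = diametric-end⇒deg≤1 ends

  v₀-neighbour : ∀ {x} → 0 < D → G v₀ x ≡ true → x ≡ P 1
  v₀-neighbour 0<D g = count≤1⇒≡ (G v₀) deg-v₀≤1 g (path-edge 0<D)

  -- Otherwise the path could be prolonged through x.
  v₁-neighbour-leaf : ∀ {x} → 1 < D → G (P 1) x ≡ true → x ≢ P 2 → deg G x ≤ 1
  v₁-neighbour-leaf {x} 1<D g x≢v₂ = diametric-end⇒deg≤1 (begin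
    d v_D x           ≡⟨ step-away v_D (path-edge 1<D) g (x≢v₂ ∘ sym) closer ⟩
    suc (d v_D (P 1)) ≡⟨ cong suc (dist-end (<⇒≤ 1<D)) ⟩
    suc (D ∸ 1)       ≡⟨ +-comm 1 (D ∸ 1) ⟩
    (D ∸ 1) + 1       ≡⟨ m∸n+n≡m (<⇒≤ 1<D) ⟩
    D                 ∎)
    where
    open ≡-Reasoning
    closer : d v_D (P 2) < d v_D (P 1)
    closer = subst₂ _<_ (sym (dist-end 1<D)) (sym (dist-end (<⇒≤ 1<D))) (∸-monoʳ-< ≤-refl 1<D)

  -- The two ends cannot both be at distance 0 from `x`. This keeps the default value of `term` out
  -- of the sum.
  1≤ecc : 0 < D → ∀ x → 1 ≤ ecc G x
  1≤ecc 0<D x = n≢0⇒n>0 λ eq → contradiction 0<D (≤⇒≯ (begin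
    D                   ≡⟨ ends ⟨
    d v₀ v_D            ≤⟨ triangle v₀ v_D x ⟩
    d v₀ x + d v_D x    ≡⟨ cong₂ _+_ (dist-sym v₀ x) (dist-sym v_D x) ⟩
    d x v₀ + d x v_D    ≤⟨ +-mono-≤ (dist≤ecc G x v₀) (dist≤ecc G x v_D) ⟩
    ecc G x + ecc G x   ≡⟨ cong₂ _+_ eq eq ⟩
    0                   ∎))
    where open ≤-Reasoning

-- Eccentricities in the new tree

module Surgery {n k} (G : Graph n) (tree : IsTree G) (P : ℕ → Fin n) (diametric : Diametric G P)
  (i : ℕ) (j<D : suc i < diam G)
  (W : Fin k → Fin n)
  (W-adj : ∀ a → G (P (suc i)) (W a) ≡ true)
  (W-off : ∀ a m → m ≤ diam G → W a ≢ P m)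
  where

  open DiametricPath G tree P diametric public

  -- From here on `i` is the index of the predecessor of `u` on the path, whereas in `theorem2` it
  -- is the index of the first branching vertex.
  j : ℕ
  j = suc i

  u : Fin n
  u = P j

  -- Opaque, so that case distinctions on membership in W do not reach into deg G′.
  opaque
    G′ : Graph n
    G′ = moveEdges G u v₀ W

    G′-def : G′ ≡ moveEdges G u v₀ W
    G′-def = refl

  j≤D : j ≤ D
  j≤D = <⇒≤ j<D

  i<D : i < D
  i<D = j≤D

  i≤D : i ≤ D
  i≤D = <⇒≤ i<D

  u≢v₀ : u ≢ v₀
  u≢v₀ eq = contradiction (P-injective j≤D z≤n eq) λ ()

  W≢P : ∀ {x m} → m ≤ D → inW W x ≡ true → x ≢ P m
  W≢P m≤D p with inW⁻ W p
  ... | a , refl = W-off a _ m≤D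

  P∉W : ∀ {m} → m ≤ D → inW W (P m) ≡ false
  P∉W m≤D = ¬-not λ p → W≢P m≤D p refl

  -- Membership in the moved branches, expressed by distances: deleting the edge from `u` to `W a`
  -- cuts off exactly the vertices closer to `W a` than to `u`.
  Beyond : Fin n → Set
  Beyond x = ∃ λ a → d (W a) x < d u x

  beyond? : ∀ x → Dec (Beyond x)
  beyond? x = Fin.any? λ a → d (W a) x <? d u x

  W-beyond : ∀ a → Beyond (W a)
  W-beyond a = a , subst (_< d u (W a)) (sym (dist-refl (W a)))
    (n≢0⇒n>0 λ eq → W-off a j j≤D (sym (dist≡0⇒≡ eq)))

  -- A neighbour of u that is closer than u to r is the one on the path, and so not in W.
  path-side : ∀ {r m} → m ≤ D → G u (P m) ≡ true → d r (P m) < d r u → ¬ Beyond r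
  path-side {r} {m} m≤D g lt (a , lt′) = W-off a m m≤D
    (closer-unique r (W-adj a) g (subst₂ _<_ (dist-sym (W a) r) (dist-sym u r) lt′) lt)

  v₀-not-beyond : ¬ Beyond v₀
  v₀-not-beyond = path-side i≤D (swap-edge (path-edge i<D))
    (subst₂ _<_ (sym (dist-start i≤D)) (sym (dist-start j≤D)) ≤-refl)

  v_D-not-beyond : ¬ Beyond v_D
  v_D-not-beyond = path-side j<D (path-edge j<D)
    (subst₂ _<_ (sym (dist-end j<D)) (sym (dist-end j≤D)) (∸-monoʳ-< ≤-refl j<D))

  -- Some `W a` is closer than `u` to `x` but not to `y`, so the path from `y` to `x` runs through
  -- `u` and then `W a`. Its length is at most 1, which forces `y` to be `u` and `x` to be `W a`.
  beyond-exit : ∀ {x y} → G x y ≡ true → Beyond x → ¬ Beyond y → inW W x ≡ true × y ≡ u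
  beyond-exit {x} {y} g (a , lt) y∉ with closer-or-farther y (W-adj a) | closer-or-farther x (W-adj a)
  ... | inj₁ p | _ = contradiction (a , subst₂ _<_ (dist-sym y (W a)) (dist-sym y u) (≤-reflexive (sym p))) y∉
  ... | inj₂ _ | inj₂ q = contradiction lt (<⇒≯ (subst₂ _<_ (dist-sym x u) (dist-sym x (W a)) (≤-reflexive (sym q))))
  ... | inj₂ p | inj₁ q = subst (λ z → inW W z ≡ true) (dist≡0⇒≡ Wax≡0) (inW⁺ W a) , dist≡0⇒≡ yu≡0
    where
    le : suc (d y u + d x (W a)) ≤ 1
    le = begin
      suc (d y u + d x (W a))   ≡⟨ +-suc (d y u) _ ⟨
      d y u + suc (d x (W a))   ≡⟨ cong (d y u +_) q ⟨
      d y u + d x u             ≡⟨ dist-through-edge (d x (W a)) (W-adj a) p q refl ⟨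
      d y x                     ≤⟨ dist-edge (swap-edge g) ⟩
      1                         ∎
      where open ≤-Reasoning
    sum≡0 : d y u + d x (W a) ≡ 0
    sum≡0 = n≤0⇒n≡0 (s≤s⁻¹ le)
    yu≡0 : d y u ≡ 0
    yu≡0 = m+n≡0⇒m≡0 _ sum≡0
    Wax≡0 : d (W a) x ≡ 0
    Wax≡0 = trans (dist-sym (W a) x) (m+n≡0⇒n≡0 (d y u) sum≡0)

  data G′-Edge (x y : Fin n) : Set where
    kept    : G x y ≡ true → ¬ (inW W x ≡ true × y ≡ u) → ¬ (inW W y ≡ true × x ≡ u) → G′-Edge x y
    from-v₀ : x ≡ v₀ → inW W y ≡ true → G′-Edge x y
    to-v₀   : y ≡ v₀ → inW W x ≡ true → G′-Edge x y

  G′-edge : ∀ {x y} → G′ x y ≡ true → G′-Edge x y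
  G′-edge {x} {y} g′ = moved-edge (subst (λ H → H x y ≡ true) G′-def g′)
    where
    moved-edge : moveEdges G u v₀ W x y ≡ true → G′-Edge x y
    moved-edge g with ∨-true⁻ (G x y ∧ not ((x == u ∧ inW W y) ∨ (y == u ∧ inW W x))) g
    ... | inj₂ new with ∨-true⁻ (x == v₀ ∧ inW W y) new
    ...   | inj₁ p = let q , r = ∧-true⁻ (x == v₀) p in from-v₀ (==⇒≡ q) r
    ...   | inj₂ p = let q , r = ∧-true⁻ (y == v₀) p in to-v₀ (==⇒≡ q) r
    moved-edge g | inj₁ old = kept g₀
      (λ (p , q) → not-removed (removed₂ p q)) (λ (p , q) → not-removed (removed₁ p q))
      where
      g₀ = proj₁ (∧-true⁻ (G x y) old)
      not-removed : ((x == u ∧ inW W y) ∨ (y == u ∧ inW W x)) ≢ true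
      not-removed r = contradiction (trans (sym (cong not r)) (proj₂ (∧-true⁻ (G x y) old))) λ ()
      removed₁ : inW W y ≡ true → x ≡ u → ((x == u ∧ inW W y) ∨ (y == u ∧ inW W x)) ≡ true
      removed₁ p refl = cong (_∨ (y == u ∧ inW W u)) (cong₂ _∧_ (==-refl u) p)
      removed₂ : inW W x ≡ true → y ≡ u → ((x == u ∧ inW W y) ∨ (y == u ∧ inW W x)) ≡ true
      removed₂ p refl = ∨-true⁺ʳ (x == u ∧ inW W u) (cong₂ _∧_ (==-refl u) p)

  -- The distance from r in the new tree for r = v₀ and r = v_D.
  potential : Fin n → Fin n → ℕ
  potential r x = if ⌊ beyond? x ⌋ then d r v₀ + d u x else d r x

  potential-beyond : ∀ {r x} → Beyond x → potential r x ≡ d r v₀ + d u x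
  potential-beyond {r} {x} b with beyond? x
  ... | yes _ = refl
  ... | no ¬b = contradiction b ¬b

  potential-not-beyond : ∀ {r x} → ¬ Beyond x → potential r x ≡ d r x
  potential-not-beyond {r} {x} ¬b with beyond? x
  ... | yes b = contradiction b ¬b
  ... | no _  = refl

  potential-W : ∀ {r x} → inW W x ≡ true → potential r x ≡ suc (potential r v₀)
  potential-W {r} p with inW⁻ W p
  ... | a , refl = begin
    potential r (W a)     ≡⟨ potential-beyond (W-beyond a) ⟩
    d r v₀ + d u (W a)    ≡⟨ cong (d r v₀ +_) (≤-antisym (dist-edge (W-adj a)) (≤-trans (s≤s z≤n) (proj₂ (W-beyond a)))) ⟩
    d r v₀ + 1            ≡⟨ +-comm (d r v₀) 1 ⟩
    suc (d r v₀)          ≡⟨ cong suc (potential-not-beyond v₀-not-beyond) ⟨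
    suc (potential r v₀)  ∎
    where open ≡-Reasoning

  -- By `beyond-exit` only deleted edges cross the boundary of the moved branches, so a kept edge
  -- has both ends inside or both outside, and an old distance function applies. Along a new edge
  -- the value changes by exactly 1.
  potential-lipschitz : ∀ r → Lipschitz G′ (potential r)
  potential-lipschitz r x y g with G′-edge g
  ... | from-v₀ refl p = ≤-trans (n≤1+n _) (≤-trans (≤-reflexive (sym (potential-W p))) (n≤1+n _))
  ... | to-v₀ refl p   = ≤-reflexive (potential-W p)
  ... | kept g₀ ¬₁ ¬₂ = go (beyond? x) (beyond? y)
    where
    go : Dec (Beyond x) → Dec (Beyond y) → potential r x ≤ suc (potential r y)
    go (yes bx) (no by)  = contradiction (beyond-exit g₀ bx by) ¬₁
    go (no bx)  (yes by) = contradiction (beyond-exit (swap-edge g₀) by bx) ¬₂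
    go (yes bx) (yes by) = subst₂ _≤_ (sym (potential-beyond bx))
      (trans (+-suc (d r v₀) (d u y)) (cong suc (sym (potential-beyond by))))
      (+-monoʳ-≤ (d r v₀) (dist-lipschitz u x y g₀))
    go (no bx)  (no by)  = subst₂ _≤_ (sym (potential-not-beyond bx)) (cong suc (sym (potential-not-beyond by)))
      (dist-lipschitz r x y g₀)

  -- `potential r` vanishes at `r` and is Lipschitz in the new graph; the premise `m ≤ n` guards
  -- against the cap in `dist`.
  potential≤⇒≤ecc : ∀ {r x m} → ¬ Beyond r → m ≤ potential r x → m ≤ n → m ≤ ecc G′ x
  potential≤⇒≤ecc {r} {x} {m} ¬b le m≤n = ≤-trans
    (lipschitz⇒≤dist G′ (potential-lipschitz r) (trans (potential-not-beyond ¬b) (dist-refl r)) le m≤n)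
    (dist≤ecc G′ x r)

  ecc-grows : ∀ x → ecc G x ≤ ecc G′ x
  ecc-grows x = go (beyond? x)
    where
    go : Dec (Beyond x) → ecc G x ≤ ecc G′ x
    go (yes b) = potential≤⇒≤ecc v_D-not-beyond
      (≤-trans (maxOver-least (d x) bound) (≤-reflexive (sym (potential-beyond b))))
      (maxOver-least (d x) (dist≤n G x))
      where
      bound : ∀ y → d x y ≤ d v_D v₀ + d u x
      bound y = begin
        d x y             ≤⟨ triangle x y u ⟩
        d x u + d y u     ≤⟨ +-monoʳ-≤ (d x u) (dist≤diam G y u) ⟩
        d x u + D         ≡⟨ +-comm (d x u) D ⟩
        D + d x u         ≡⟨ cong₂ _+_ (trans (dist-sym v_D v₀) ends) (dist-sym u x) ⟨
        d v_D v₀ + d u x  ∎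
        where open ≤-Reasoning
    go (no ¬b) = ecc≤-from-ends ends x (toEnd v₀-not-beyond) (toEnd v_D-not-beyond)
      where
      toEnd : ∀ {r} → ¬ Beyond r → d x r ≤ ecc G′ x
      toEnd {r} ¬r = potential≤⇒≤ecc ¬r
        (≤-reflexive (trans (dist-sym x r) (sym (potential-not-beyond ¬b)))) (dist≤n G x r)

-- Degrees in the new tree

==-sym : ∀ {n} (x y : Fin n) → (x == y) ≡ (y == x)
==-sym x y with x Fin.≟ y | y Fin.≟ x
... | yes _    | yes _  = refl
... | no _     | no _   = refl
... | yes refl | no y≢x = contradiction refl y≢x
... | no x≢y   | yes y≡x = contradiction (sym y≡x) x≢y

∏≤-factor : ∀ {n} (f : Fin n → ℕ) a → (∀ y → y ≢ a → f y ≤ 1) → ∏ f ≤ f a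
∏≤-factor {n} f a f≤1 = begin
  ∏ f                    ≡⟨ ∏-extract f a ⟩
  f a * ∏ (except a f)   ≤⟨ *-monoʳ-≤ (f a) (∏-mono {g = λ _ → 1} pointwise) ⟩
  f a * ∏ {n} (λ _ → 1)    ≡⟨ cong (f a *_) (∏-one {n} {λ _ → 1} λ _ → refl) ⟩
  f a * 1                ≡⟨ *-identityʳ (f a) ⟩
  f a                    ∎
  where
  open ≤-Reasoning
  pointwise : ∀ y → except a f y ≤ 1
  pointwise y with y Fin.≟ a
  ... | yes _  = ≤-refl
  ... | no y≢a = f≤1 y y≢a

count-inW : ∀ {n k} (W : Fin k → Fin n) → Injective _≡_ _≡_ W → count (inW W) ≡ k
count-inW {n} {k} W W-inj = begin
  count (inW W)                            ≡⟨ count≡∑ (inW W) ⟩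
  ∑ (λ x → ι (inW W x))                    ≡⟨ ∑-cong hits ⟩
  ∑ (λ x → ∑ (λ a → ι (W a == x)))         ≡⟨ ∑-comm (λ x a → ι (W a == x)) ⟩
  ∑ (λ a → ∑ (λ x → ι (W a == x)))         ≡⟨ ∑-cong (λ a → trans (∑-cong (λ x → cong ι (==-sym (W a) x))) (∑-δ (W a))) ⟩
  ∑ {k} (λ a → 1)                          ≡⟨ ∑-one k ⟩
  k                                        ∎
  where
  open ≡-Reasoning
  W-== : ∀ a b → (W b == W a) ≡ (b == a)
  W-== a b with b Fin.≟ a
  ... | yes refl = ==-refl (W b)
  ... | no b≢a   = ≢⇒== (b≢a ∘ W-inj)
  hits : ∀ x → ι (inW W x) ≡ ∑ (λ a → ι (W a == x))
  hits x with inW W x in eq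
  ... | false = sym (∑-zero {k} {λ a → ι (W a == x)} λ a → cong ι (≢⇒== (λ { refl → contradiction (trans (sym eq) (inW⁺ W a)) λ () })))
  ... | true with inW⁻ W eq
  ...   | a , refl = sym (trans (∑-cong (λ b → cong ι (W-== a b))) (∑-δ a))

factor : ∀ {n} → Graph n → Fin n → Fin n → ℕ
factor G x y = if G x y then deg G y else 1

M≡∏ : ∀ {n} (G : Graph n) x → M G x ≡ ∏ (factor G x)
M≡∏ G x = product-allFin (factor G x)

factor-edge : ∀ {n} (G : Graph n) {x y} → G x y ≡ true → factor G x y ≡ deg G y
factor-edge G {x} {y} g = cong (if_then deg G y else 1) g

factor-nonadjacent : (G : Graph n) {x y : Fin n} → G x y ≡ false → factor G x y ≡ 1
factor-nonadjacent G {x} {y} g = cong (if_then deg G y else 1) g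

factor≥1 : ∀ {n} {G : Graph n} → Symmetric G → ∀ x y → 1 ≤ factor G x y
factor≥1 {G = G} G-sym x y with G x y in eq
... | false = ≤-refl
... | true  = true⇒1≤count (G y) (trans (G-sym y x) eq)

factor≤ : ∀ {n} (G : Graph n) {x y m} → 1 ≤ m → (G x y ≡ true → deg G y ≤ m) → factor G x y ≤ m
factor≤ G {x} {y} 1≤m h with G x y
... | false = 1≤m
... | true  = h refl

-- `h` stands for `deg u` minus `k + 1`, so that `u` keeps `suc h` neighbours; the equation `deg-u`
-- avoids truncated subtraction.
module SurgeryDegrees {n k} (G : Graph n) (tree : IsTree G) (P : ℕ → Fin n) (diametric : Diametric G P)
  (i : ℕ) (j<D : suc i < diam G)
  (W : Fin k → Fin n)
  (W-adj : ∀ a → G (P (suc i)) (W a) ≡ true)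
  (W-off : ∀ a m → m ≤ diam G → W a ≢ P m)
  (W-inj : Injective _≡_ _≡_ W)
  (1≤k : 1 ≤ k) (h : ℕ) (deg-u : deg G (P (suc i)) ≡ k + suc h)
  where

  open Surgery G tree P diametric i j<D W W-adj W-off public

  0<D : 0 < D
  0<D = ≤-trans (s≤s z≤n) j≤D

  1<D : 1 < D
  1<D = ≤-trans (s≤s (s≤s z≤n)) j<D

  W-u : ∀ {x} → inW W x ≡ true → G u x ≡ true
  W-u p with inW⁻ W p
  ... | a , refl = W-adj a

  opaque
    unfolding G′

    G′-u : ∀ y → G′ u y ≡ G u y ∧ not (inW W y)
    G′-u y rewrite ==-refl u | ≢⇒== u≢v₀ | P∉W j≤D | ∧-zeroʳ (y == u) | ∧-zeroʳ (y == v₀)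
      | ∨-identityʳ (inW W y) = ∨-identityʳ _

    G′-v₀ : ∀ y → G′ v₀ y ≡ G v₀ y ∨ inW W y
    G′-v₀ y rewrite ==-refl v₀ | ≢⇒== (u≢v₀ ∘ sym) | P∉W {0} z≤n | ∧-zeroʳ (y == u) | ∧-zeroʳ (y == v₀)
      | ∨-identityʳ (inW W y) | ∧-identityʳ (G v₀ y) = refl

    G′-W : ∀ {x} → inW W x ≡ true → ∀ y → G′ x y ≡ (G x y ∧ not (y == u)) ∨ (y == v₀)
    G′-W {x} p y rewrite ≢⇒== (W≢P j≤D p) | ≢⇒== (W≢P {m = 0} z≤n p) | p
      | ∧-identityʳ (y == u) | ∧-identityʳ (y == v₀) = refl

    G′-other : ∀ {x} → x ≢ u → x ≢ v₀ → inW W x ≡ false → ∀ y → G′ x y ≡ G x y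
    G′-other {x} x≢u x≢v₀ x∉W y rewrite ≢⇒== x≢u | ≢⇒== x≢v₀ | x∉W | ∧-zeroʳ (y == u) | ∧-zeroʳ (y == v₀)
      | ∧-identityʳ (G x y) = ∨-identityʳ _

  deg′-u : deg G′ u ≤ suc h
  deg′-u = +-cancelˡ-≤ k _ _ (≤-reflexive (begin
    k + deg G′ u                                 ≡⟨ cong₂ _+_ (sym (count-inW W W-inj)) refl ⟩
    count (inW W) + deg G′ u                     ≡⟨ cong₂ _+_ (count≡∑ (inW W)) (count≡∑ (G′ u)) ⟩
    ∑ (λ y → ι (inW W y)) + ∑ (λ y → ι (G′ u y)) ≡⟨ ∑-distrib-+ (λ y → ι (inW W y)) (λ y → ι (G′ u y)) ⟨
    ∑ (λ y → ι (inW W y) + ι (G′ u y))           ≡⟨ ∑-cong pointwise ⟩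
    ∑ (λ y → ι (G u y))                          ≡⟨ count≡∑ (G u) ⟨
    deg G u                                      ≡⟨ deg-u ⟩
    k + suc h                                    ∎))
    where
    open ≡-Reasoning
    pointwise : ∀ y → ι (inW W y) + ι (G′ u y) ≡ ι (G u y)
    pointwise y rewrite G′-u y with inW W y in p
    ... | true  rewrite W-u p = refl
    ... | false = cong ι (∧-identityʳ (G u y))

  deg′-v₀ : deg G′ v₀ ≤ suc k
  deg′-v₀ = begin
    deg G′ v₀                                    ≡⟨ count≡∑ (G′ v₀) ⟩
    ∑ (λ y → ι (G′ v₀ y))                        ≤⟨ ∑-mono pointwise ⟩
    ∑ (λ y → ι (G v₀ y) + ι (inW W y))           ≡⟨ ∑-distrib-+ (λ y → ι (G v₀ y)) (λ y → ι (inW W y)) ⟩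
    ∑ (λ y → ι (G v₀ y)) + ∑ (λ y → ι (inW W y)) ≡⟨ cong₂ _+_ (count≡∑ (G v₀)) (count≡∑ (inW W)) ⟨
    deg G v₀ + count (inW W)                     ≤⟨ +-mono-≤ deg-v₀≤1 (≤-reflexive (count-inW W W-inj)) ⟩
    suc k                                        ∎
    where
    open ≤-Reasoning
    pointwise : ∀ y → ι (G′ v₀ y) ≤ ι (G v₀ y) + ι (inW W y)
    pointwise y rewrite G′-v₀ y with G v₀ y
    ... | true  = s≤s z≤n
    ... | false = ≤-refl

  -- A moved vertex trades its neighbour `u` for `v₀`. The inequality becomes termwise once `u` is
  -- added back on the left and `v₀` is added on the right.
  deg′-W : ∀ {x} → inW W x ≡ true → deg G′ x ≤ deg G x
  deg′-W {x} p = +-cancelˡ-≤ 1 _ _ (begin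
    1 + deg G′ x                                   ≡⟨ cong₂ _+_ (sym (∑-δ u)) (count≡∑ (G′ x)) ⟩
    ∑ (λ y → ι (y == u)) + ∑ (λ y → ι (G′ x y))    ≡⟨ ∑-distrib-+ (λ y → ι (y == u)) (λ y → ι (G′ x y)) ⟨
    ∑ (λ y → ι (y == u) + ι (G′ x y))              ≤⟨ ∑-mono pointwise ⟩
    ∑ (λ y → ι (y == v₀) + ι (G x y))              ≡⟨ ∑-distrib-+ (λ y → ι (y == v₀)) (λ y → ι (G x y)) ⟩
    ∑ (λ y → ι (y == v₀)) + ∑ (λ y → ι (G x y))    ≡⟨ cong₂ _+_ (∑-δ v₀) (sym (count≡∑ (G x))) ⟩
    1 + deg G x                                    ∎)
    where
    open ≤-Reasoning
    pointwise : ∀ y → ι (y == u) + ι (G′ x y) ≤ ι (y == v₀) + ι (G x y)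
    pointwise y rewrite G′-W p y with y Fin.≟ u | y Fin.≟ v₀
    ... | yes refl | yes eq = contradiction eq u≢v₀
    ... | yes refl | no _  rewrite swap-edge (W-u p) = ≤-refl
    ... | no _     | yes _ with G x y
    ...   | true  = s≤s z≤n
    ...   | false = ≤-refl
    pointwise y | no _ | no _ rewrite ∧-identityʳ (G x y) | ∨-identityʳ (G x y) = ≤-refl

  deg′≤ : ∀ {x} → x ≢ u → x ≢ v₀ → deg G′ x ≤ deg G x
  deg′≤ {x} x≢u x≢v₀ = go (inW W x) refl
    where
    go : ∀ b → inW W x ≡ b → deg G′ x ≤ deg G x
    go true  x∈W = deg′-W x∈W
    go false x∉W = ≤-reflexive (trans (count≡∑ (G′ x))
      (trans (∑-cong λ y → cong ι (G′-other x≢u x≢v₀ x∉W y)) (sym (count≡∑ (G x)))))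

  2≤deg-u : 2 ≤ deg G u
  2≤deg-u = ≤-trans (+-mono-≤ 1≤k (s≤s z≤n)) (≤-reflexive (sym deg-u))

  deg≤1⇒≢u : ∀ {x} → deg G x ≤ 1 → x ≢ u
  deg≤1⇒≢u le refl = contradiction le (<⇒≱ 2≤deg-u)

  factor-mono : ∀ {x y} → x ≢ u → x ≢ v₀ → inW W x ≡ false → y ≢ u → y ≢ v₀ → factor G′ x y ≤ factor G x y
  factor-mono {x} {y} x≢u x≢v₀ x∉W y≢u y≢v₀ rewrite G′-other x≢u x≢v₀ x∉W y with G x y
  ... | true  = deg′≤ y≢u y≢v₀
  ... | false = ≤-refl

  -- The neighbourhood of such an `x` is unchanged, and `v₀`, the only vertex whose degree can grow,
  -- is not in it.
  M-other : ∀ {x} → x ≢ u → x ≢ v₀ → inW W x ≡ false → G x u ≡ false → G x v₀ ≡ false → M G′ x ≤ M G x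
  M-other {x} x≢u x≢v₀ x∉W xu xv₀ = subst₂ _≤_ (sym (M≡∏ G′ x)) (sym (M≡∏ G x)) (∏-mono pointwise)
    where
    pointwise : ∀ y → factor G′ x y ≤ factor G x y
    pointwise y with y Fin.≟ u | y Fin.≟ v₀
    ... | no y≢u   | no y≢v₀  = factor-mono x≢u x≢v₀ x∉W y≢u y≢v₀
    ... | yes refl | _        = ≤-reflexive (trans (factor-nonadjacent G′ (trans (G′-other x≢u x≢v₀ x∉W u) xu))
                                              (sym (factor-nonadjacent G xu)))
    ... | no _     | yes refl = ≤-reflexive (trans (factor-nonadjacent G′ (trans (G′-other x≢u x≢v₀ x∉W v₀) xv₀))
                                              (sym (factor-nonadjacent G xv₀)))

  -- For `x` adjacent to `u` this is `M G x` divided by `deg G u`; in `M-neighbour` and `M-W` it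
  -- bounds what the other neighbours contribute after the move.
  cofactor : Fin n → ℕ
  cofactor x = ∏ (except u (factor G x))

  M-cofactor : ∀ {x} → G u x ≡ true → M G x ≡ (k + suc h) * cofactor x
  M-cofactor {x} g = begin
    M G x                       ≡⟨ M≡∏ G x ⟩
    ∏ (factor G x)              ≡⟨ ∏-extract (factor G x) u ⟩
    factor G x u * cofactor x   ≡⟨ cong (_* cofactor x) (trans (factor-edge G (swap-edge g)) deg-u) ⟩
    (k + suc h) * cofactor x    ∎
    where open ≡-Reasoning

  cofactor≥deg : ∀ {x y} → G x y ≡ true → y ≢ u → deg G y ≤ cofactor x
  cofactor≥deg {x} {y} g y≢u = subst (_≤ cofactor x)
    (trans (except-≢ (factor G x) y≢u) (factor-edge G g))
    (factor≤∏ y (except≥1 u (factor≥1 G-sym x)))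

  cofactor≥1 : ∀ x → 1 ≤ cofactor x
  cofactor≥1 x = ∏≥1 (except≥1 u (factor≥1 G-sym x))

  -- The factor of `u` drops from `k + suc h` to at most `suc h`, and no other factor grows.
  M-neighbour : ∀ {x} → x ≢ v₀ → inW W x ≡ false → G u x ≡ true → G x v₀ ≡ false →
    M G′ x + k * cofactor x ≤ M G x
  M-neighbour {x} x≢v₀ x∉W ux xv₀ = begin
    M G′ x + k * R                           ≡⟨ cong (_+ k * R) (trans (M≡∏ G′ x) (∏-extract (factor G′ x) u)) ⟩
    factor G′ x u * ∏ (except u (factor G′ x)) + k * R
                                             ≤⟨ +-monoˡ-≤ (k * R)
      (*-mono-≤ (factor≤ G′ {x} {u} (s≤s z≤n) (λ _ → deg′-u)) (∏-mono pointwise)) ⟩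
    suc h * R + k * R                        ≡⟨ +-comm (suc h * R) (k * R) ⟩
    k * R + suc h * R                        ≡⟨ *-distribʳ-+ R k (suc h) ⟨
    (k + suc h) * R                          ≡⟨ M-cofactor ux ⟨
    M G x                                    ∎
    where
    open ≤-Reasoning
    R = cofactor x
    x≢u : x ≢ u
    x≢u refl = contradiction (trans (sym ux) (G-irrefl u)) λ ()
    pointwise : ∀ y → except u (factor G′ x) y ≤ except u (factor G x) y
    pointwise y with y Fin.≟ u | y Fin.≟ v₀
    ... | yes _  | _        = ≤-refl
    ... | no y≢u | no y≢v₀  = factor-mono x≢u x≢v₀ x∉W y≢u y≢v₀
    ... | no _   | yes refl = ≤-reflexive (trans (factor-nonadjacent G′ (trans (G′-other x≢u x≢v₀ x∉W v₀) xv₀))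
                                              (sym (factor-nonadjacent G xv₀)))

  -- The factor `k + suc h` of `u` gives way to a factor of at most `suc k` for `v₀`, a drop of `h`
  -- times a cofactor that is at least 1.
  M-W : ∀ {x} → inW W x ≡ true → M G′ x + h ≤ M G x
  M-W {x} p = begin
    M G′ x + h                ≡⟨ cong (_+ h) (trans (M≡∏ G′ x) (∏-extract (factor G′ x) v₀)) ⟩
    factor G′ x v₀ * ∏ (except v₀ (factor G′ x)) + h
                              ≤⟨ +-mono-≤ (*-mono-≤ (factor≤ G′ {x} {v₀} (s≤s z≤n) (λ _ → deg′-v₀)) (∏-mono pointwise))
                                   (≤-trans (≤-reflexive (sym (*-identityʳ h))) (*-monoʳ-≤ h (cofactor≥1 x))) ⟩
    suc k * R + h * R         ≡⟨ lemma k h R ⟩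
    (k + suc h) * R           ≡⟨ M-cofactor (W-u p) ⟨
    M G x                     ∎
    where
    open ≤-Reasoning
    R = cofactor x
    lemma : ∀ k h R → suc k * R + h * R ≡ (k + suc h) * R
    lemma = solve-∀
    pointwise : ∀ y → except v₀ (factor G′ x) y ≤ except u (factor G x) y
    pointwise y with y Fin.≟ u | y Fin.≟ v₀ | G′-W p y
    ... | yes _    | yes _   | _ = ≤-refl
    ... | no _     | yes _   | _ = factor≥1 G-sym x y
    ... | yes refl | no _    | eq = ≤-reflexive (factor-nonadjacent G′ (trans eq (trans (∨-identityʳ _) (∧-zeroʳ (G x u)))))
    ... | no y≢u   | no y≢v₀ | eq rewrite trans eq (trans (∨-identityʳ _) (∧-identityʳ (G x y))) with G x y
    ...   | true  = deg′≤ y≢u y≢v₀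
    ...   | false = ≤-refl

  ∏W : ℕ
  ∏W = ∏ (λ y → if inW W y then deg G y else 1)

  ∏W≥1 : 1 ≤ ∏W
  ∏W≥1 = ∏≥1 pointwise
    where
    pointwise : ∀ y → 1 ≤ (if inW W y then deg G y else 1)
    pointwise y with inW W y in p
    ... | true  = true⇒1≤count (G y) (swap-edge (W-u p))
    ... | false = ≤-refl

  M-rest : ℕ
  M-rest = ∏ (λ y → if G u y ∧ not (inW W y) then deg G y else 1)

  M-u : M G u ≡ M-rest * ∏W
  M-u = trans (M≡∏ G u) (trans (∏-cong pointwise) (∏-distrib-* (λ y → if G u y ∧ not (inW W y) then deg G y else 1) _))
    where
    pointwise : ∀ y → factor G u y ≡ (if G u y ∧ not (inW W y) then deg G y else 1) * (if inW W y then deg G y else 1)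
    pointwise y with inW W y in p
    ... | true  rewrite W-u p = sym (*-identityˡ _)
    ... | false rewrite ∧-identityʳ (G u y) = sym (*-identityʳ _)

  M′-u : G u v₀ ≡ false → M G′ u ≤ M-rest
  M′-u uv₀ = ≤-trans (≤-reflexive (M≡∏ G′ u)) (∏-mono pointwise)
    where
    pointwise : ∀ y → factor G′ u y ≤ (if G u y ∧ not (inW W y) then deg G y else 1)
    pointwise y rewrite G′-u y with G u y in uy | inW W y
    ... | false | _     = ≤-refl
    ... | true  | true  = ≤-refl
    ... | true  | false = deg′≤ (λ { refl → contradiction (trans (sym uy) (G-irrefl u)) λ () })
                                (λ { refl → contradiction (trans (sym uy) uv₀) λ () })

  deg-P-i≤M-rest : deg G (P i) ≤ M-rest
  deg-P-i≤M-rest = subst (_≤ M-rest) (cong (if_then deg G (P i) else 1) keep) (factor≤∏ (P i) pointwise)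
    where
    keep : G u (P i) ∧ not (inW W (P i)) ≡ true
    keep = cong₂ (λ a b → a ∧ not b) (swap-edge (path-edge i<D)) (P∉W i≤D)
    pointwise : ∀ y → 1 ≤ (if G u y ∧ not (inW W y) then deg G y else 1)
    pointwise y with G u y in uy | inW W y
    ... | false | _     = ≤-refl
    ... | true  | true  = ≤-refl
    ... | true  | false = true⇒1≤count (G y) (swap-edge uy)

  M-v₀≤ : M G v₀ ≤ deg G (P 1)
  M-v₀≤ = begin
    M G v₀               ≡⟨ M≡∏ G v₀ ⟩
    ∏ (factor G v₀)      ≤⟨ ∏≤-factor (factor G v₀) (P 1) others ⟩
    factor G v₀ (P 1)    ≡⟨ factor-edge G (path-edge 0<D) ⟩
    deg G (P 1)          ∎
    where
    open ≤-Reasoning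
    others : ∀ y → y ≢ P 1 → factor G v₀ y ≤ 1
    others y y≢ = factor≤ G ≤-refl λ g → contradiction (v₀-neighbour 0<D g) y≢

  -- The neighbourhood of `v₀` gains just the moved vertices, and neither their degrees nor that of
  -- `v₁` grow.
  M′-v₀ : G v₀ u ≡ false → M G′ v₀ ≤ M G v₀ * ∏W
  M′-v₀ v₀u = begin
    M G′ v₀                   ≡⟨ M≡∏ G′ v₀ ⟩
    ∏ (factor G′ v₀)          ≤⟨ ∏-mono pointwise ⟩
    ∏ (λ y → factor G v₀ y * (if inW W y then deg G y else 1))
                              ≡⟨ ∏-distrib-* (factor G v₀) (λ y → if inW W y then deg G y else 1) ⟩
    ∏ (factor G v₀) * ∏W      ≡⟨ cong (_* ∏W) (M≡∏ G v₀) ⟨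
    M G v₀ * ∏W               ∎
    where
    open ≤-Reasoning
    pointwise : ∀ y → factor G′ v₀ y ≤ factor G v₀ y * (if inW W y then deg G y else 1)
    pointwise y rewrite G′-v₀ y with G v₀ y in g | inW W y in p
    ... | false | false = ≤-refl
    ... | false | true  = ≤-trans (deg′-W p) (≤-reflexive (sym (+-identityʳ _)))
    ... | true  | true  = contradiction (v₀-neighbour 0<D g) (W≢P {m = 1} (<⇒≤ 1<D) p)
    ... | true  | false = ≤-trans (deg′≤ (λ { refl → contradiction (trans (sym g) v₀u) λ () })
                                    (λ { refl → contradiction (trans (sym g) (G-irrefl v₀)) λ () }))
                            (≤-reflexive (sym (*-identityʳ _)))

  M-v₁≥ : deg G (P 2) ≤ M G (P 1)
  M-v₁≥ = subst₂ _≤_ (factor-edge G (path-edge 1<D)) (sym (M≡∏ G (P 1))) (factor≤∏ (P 2) (factor≥1 G-sym (P 1)))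

  v₂≢v₀ : P 2 ≢ v₀
  v₂≢v₀ = P≢P 1<D z≤n λ ()

  -- All neighbours of v₁ other than v₂ are leaves of G.
  M′-v₁ : ∀ {b} → 1 ≤ b → deg G′ (P 2) ≤ b → M G′ (P 1) ≤ suc k * b
  M′-v₁ {b} 1≤b v₂≤b = begin
    M G′ (P 1)                              ≡⟨ trans (M≡∏ G′ (P 1)) (∏-extract (factor G′ (P 1)) v₀) ⟩
    factor G′ (P 1) v₀ * ∏ (except v₀ (factor G′ (P 1)))
                                            ≤⟨ *-mono-≤ (factor≤ G′ {P 1} {v₀} (s≤s z≤n) (λ _ → deg′-v₀))
      (∏≤-factor (except v₀ (factor G′ (P 1))) (P 2) others) ⟩
    suc k * except v₀ (factor G′ (P 1)) (P 2) ≡⟨ cong (suc k *_) (except-≢ (factor G′ (P 1)) v₂≢v₀) ⟩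
    suc k * factor G′ (P 1) (P 2)           ≤⟨ *-monoʳ-≤ (suc k) (factor≤ G′ 1≤b λ _ → v₂≤b) ⟩
    suc k * b                               ∎
    where
    open ≤-Reasoning
    old-edge : ∀ {y} → y ≢ v₀ → G′ (P 1) y ≡ true → G (P 1) y ≡ true
    old-edge y≢v₀ g with G′-edge g
    ... | kept g₀ _ _ = g₀
    ... | from-v₀ eq _ = contradiction (P-injective (<⇒≤ 1<D) z≤n eq) λ ()
    ... | to-v₀ eq _   = contradiction eq y≢v₀
    others : ∀ y → y ≢ P 2 → except v₀ (factor G′ (P 1)) y ≤ 1
    others y y≢v₂ with y Fin.≟ v₀
    ... | yes _   = ≤-refl
    ... | no y≢v₀ = factor≤ G′ ≤-refl λ g →
      let leaf = v₁-neighbour-leaf 1<D (old-edge y≢v₀ g) y≢v₂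
      in ≤-trans (deg′≤ (deg≤1⇒≢u leaf) y≢v₀) leaf

-- Comparison of weighted sums

when : Bool → ℕ → ℕ
when b m = if b then m else 0

∑-when : ∀ {n} (p : Fin n → Bool) m → ∑ (λ x → when (p x) m) ≡ count p * m
∑-when {n} p m = begin
  ∑ (λ x → when (p x) m)   ≡⟨ ∑-cong (λ x → when≡ (p x)) ⟩
  ∑ (λ x → ι (p x) * m)    ≡⟨ ∑-*ʳ (λ x → ι (p x)) m ⟩
  ∑ (λ x → ι (p x)) * m    ≡⟨ cong (_* m) (count≡∑ p) ⟨
  count p * m              ∎
  where
  open ≡-Reasoning
  when≡ : ∀ b → when b m ≡ ι b * m
  when≡ true  = sym (+-identityʳ m)
  when≡ false = refl

∑-when-== : ∀ {n} (a : Fin n) m → ∑ (λ x → when (x == a) m) ≡ m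
∑-when-== a m = begin
  ∑ (λ x → when (x == a) m)  ≡⟨ ∑-when (_== a) m ⟩
  count (_== a) * m          ≡⟨ cong (_* m) (trans (count≡∑ (_== a)) (∑-δ a)) ⟩
  1 * m                      ≡⟨ *-identityˡ m ⟩
  m                          ∎
  where open ≡-Reasoning

scale-gain : ∀ c {q m′ m s} → m′ + s ≤ m → q ≤ c → c * m′ + s * q ≤ c * m
scale-gain c {q} {m′} {m} {s} le q≤c = begin
  c * m′ + s * q  ≤⟨ +-monoʳ-≤ (c * m′) (≤-trans (*-monoʳ-≤ s q≤c) (≤-reflexive (*-comm s c))) ⟩
  c * m′ + c * s  ≡⟨ *-distribˡ-+ c m′ s ⟨
  c * (m′ + s)    ≤⟨ *-monoʳ-≤ c le ⟩
  c * m           ∎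
  where open ≤-Reasoning

scale-loss : ∀ c {p m′ m s} → m′ ≤ m + s → c ≤ p → c * m′ ≤ c * m + s * p
scale-loss c {p} {m′} {m} {s} le c≤p = begin
  c * m′          ≤⟨ *-monoʳ-≤ c le ⟩
  c * (m + s)     ≡⟨ *-distribˡ-+ c m s ⟩
  c * m + c * s   ≤⟨ +-monoʳ-≤ (c * m) (≤-trans (*-monoˡ-≤ s c≤p) (≤-reflexive (*-comm p s))) ⟩
  c * m + s * p   ∎
  where open ≤-Reasoning

-- In the application `c x`, `p` and `q` are `D !` divided by the eccentricity of `x`, by `D ∸ 1`
-- and by `D`. These values enter below only through inequalities.
module WeightedSum {n k} (G : Graph n) (tree : IsTree G) (P : ℕ → Fin n) (diametric : Diametric G P)
  (i : ℕ) (j<D : suc i < diam G)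
  (W : Fin k → Fin n)
  (W-adj : ∀ a → G (P (suc i)) (W a) ≡ true)
  (W-off : ∀ a m → m ≤ diam G → W a ≢ P m)
  (W-inj : Injective _≡_ _≡_ W)
  (1≤k : 1 ≤ k) (h : ℕ) (1≤h : 1 ≤ h) (deg-u : deg G (P (suc i)) ≡ k + suc h)
  (c : Fin n → ℕ) (p q : ℕ) (q≤c : ∀ x → q ≤ c x) (c-v₁≤p : c (P 1) ≤ p) (c-v₀≤q : c (P 0) ≤ q)
  where

  open SurgeryDegrees G tree P diametric i j<D W W-adj W-off W-inj 1≤k h deg-u public

  Decreases : Set
  Decreases = ∑ (λ x → c x * M G′ x) < ∑ (λ x → c x * M G x)

  -- gain x and loss x bound the decrease and the increase of the weighted
  -- value at x; e is the neighbour of u that needs separate treatment.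
  module Ledger (e : Fin n) (ue : G u e ≡ true) (e∉W : inW W e ≡ false) (a₁ a₂ b₂ : ℕ) where

    -- By `count-plain` there are `h` of these: of the `k + suc h` neighbours of `u`, `k` move and
    -- `e` is set aside.
    plain : Fin n → Bool
    plain x = not (inW W x) ∧ (G u x ∧ not (x == e))

    gain loss : Fin n → ℕ
    gain x = when (inW W x) (h * q) + (when (plain x) (k * q) + (when (x == u) a₁ + when (x == e) a₂))
    loss x = when (x == v₀) a₁ + when (x == P 1) b₂

    count-plain : count plain ≡ h
    count-plain = suc-injective (+-cancelˡ-≡ k _ _ (begin
      k + suc (count plain)          ≡⟨ cong (λ t → k + t) (+-comm 1 (count plain)) ⟩
      k + (count plain + 1)          ≡⟨ cong₂ (λ a b → a + (b + 1)) (trans (sym (count-inW W W-inj)) (count≡∑ (inW W))) (count≡∑ plain) ⟩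
      ∑ (λ x → ι (inW W x)) + (∑ (λ x → ι (plain x)) + 1)
                                     ≡⟨ cong (λ t → ∑ (λ x → ι (inW W x)) + (∑ (λ x → ι (plain x)) + t)) (∑-δ e) ⟨
      ∑ (λ x → ι (inW W x)) + (∑ (λ x → ι (plain x)) + ∑ (λ x → ι (x == e)))
                                     ≡⟨ cong (∑ (λ x → ι (inW W x)) +_) (∑-distrib-+ (λ x → ι (plain x)) (λ x → ι (x == e))) ⟨
      ∑ (λ x → ι (inW W x)) + ∑ (λ x → ι (plain x) + ι (x == e))
                                     ≡⟨ ∑-distrib-+ (λ x → ι (inW W x)) (λ x → ι (plain x) + ι (x == e)) ⟨
      ∑ (λ x → ι (inW W x) + (ι (plain x) + ι (x == e)))
                                     ≡⟨ ∑-cong pointwise ⟩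
      ∑ (λ x → ι (G u x))            ≡⟨ count≡∑ (G u) ⟨
      deg G u                        ≡⟨ deg-u ⟩
      k + suc h                      ∎))
      where
      open ≡-Reasoning
      pointwise : ∀ x → ι (inW W x) + (ι (plain x) + ι (x == e)) ≡ ι (G u x)
      pointwise x with x Fin.≟ e
      ... | yes refl rewrite e∉W | ue = refl
      ... | no _ with inW W x in w
      ...   | true  rewrite W-u w = refl
      ...   | false rewrite ∧-identityʳ (G u x) = +-identityʳ _

    ∑-gain : ∑ gain ≡ k * (h * q) + (h * (k * q) + (a₁ + a₂))
    ∑-gain = begin
      ∑ gain
        ≡⟨ ∑-distrib-+ f₁ (λ x → f₂ x + (f₃ x + f₄ x)) ⟩
      ∑ f₁ + ∑ (λ x → f₂ x + (f₃ x + f₄ x))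
        ≡⟨ cong (∑ f₁ +_) (∑-distrib-+ f₂ (λ x → f₃ x + f₄ x)) ⟩
      ∑ f₁ + (∑ f₂ + ∑ (λ x → f₃ x + f₄ x))
        ≡⟨ cong (λ t → ∑ f₁ + (∑ f₂ + t)) (∑-distrib-+ f₃ f₄) ⟩
      ∑ f₁ + (∑ f₂ + (∑ f₃ + ∑ f₄))
        ≡⟨ cong₂ _+_ (trans (∑-when (inW W) (h * q)) (cong (_* (h * q)) (count-inW W W-inj)))
             (cong₂ _+_ (trans (∑-when plain (k * q)) (cong (_* (k * q)) count-plain))
               (cong₂ _+_ (∑-when-== u a₁) (∑-when-== e a₂))) ⟩
      k * (h * q) + (h * (k * q) + (a₁ + a₂)) ∎
      where
      open ≡-Reasoning
      f₁ f₂ f₃ f₄ : Fin n → ℕ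
      f₁ x = when (inW W x) (h * q)
      f₂ x = when (plain x) (k * q)
      f₃ x = when (x == u) a₁
      f₄ x = when (x == e) a₂

    ∑-loss : ∑ loss ≡ a₁ + b₂
    ∑-loss = trans (∑-distrib-+ (λ x → when (x == v₀) a₁) (λ x → when (x == P 1) b₂))
      (cong₂ _+_ (∑-when-== v₀ a₁) (∑-when-== (P 1) b₂))

    e≢u : e ≢ u
    e≢u refl = contradiction (trans (sym ue) (G-irrefl u)) λ ()

    gain-W : ∀ {x} → inW W x ≡ true → gain x ≡ h * q
    gain-W {x} w rewrite w | ≢⇒== (W≢P j≤D w) | ≢⇒== {x = x} {e} (λ { refl → contradiction (trans (sym w) e∉W) λ () })
      = +-identityʳ _

    gain-plain : ∀ {x} → inW W x ≡ false → x ≢ u → x ≢ e → G u x ≡ true → gain x ≡ k * q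
    gain-plain {x} w x≢u x≢e g rewrite w | ≢⇒== x≢u | ≢⇒== x≢e | g = +-identityʳ _

    gain-other : ∀ {x} → inW W x ≡ false → x ≢ u → x ≢ e → G u x ≡ false → gain x ≡ 0
    gain-other {x} w x≢u x≢e g rewrite w | ≢⇒== x≢u | ≢⇒== x≢e | g = refl

    gain-u : gain u ≡ a₁
    gain-u rewrite P∉W j≤D | G-irrefl u | ==-refl u | ≢⇒== (e≢u ∘ sym) = +-identityʳ _

    gain-e : gain e ≡ a₂
    gain-e rewrite e∉W | ue | ==-refl e | ≢⇒== e≢u = refl

    loss-v₀ : a₁ ≤ loss v₀
    loss-v₀ rewrite ==-refl v₀ = m≤m+n a₁ _

    loss-v₁ : b₂ ≤ loss (P 1)
    loss-v₁ rewrite ==-refl (P 1) = m≤n+m b₂ _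

    -- The amount `a₁` is gained at `u` and lost at `v₀`, so it cancels; the loss `b₂` at `v₁` has
    -- to be outweighed by the neighbours of `u`. The premises at `u` and `e` carry `loss` on the
    -- right because either vertex may itself be `v₁`.
    balance :
      (c u * M G′ u + a₁ ≤ c u * M G u + loss u) →
      (c e * M G′ e + a₂ ≤ c e * M G e + loss e) →
      (∀ {x} → inW W x ≡ false → G u x ≡ true → x ≢ e → c x * M G′ x + k * q ≤ c x * M G x) →
      (G u v₀ ≡ false → c v₀ * M G′ v₀ ≤ c v₀ * M G v₀ + a₁) →
      (P 1 ≢ u → P 1 ≢ e → c (P 1) * M G′ (P 1) ≤ c (P 1) * M G (P 1) + b₂) →
      b₂ < k * (h * q) + (h * (k * q) + a₂) →
      Decreases
    balance at-u at-e at-plain at-v₀ at-v₁ win = +-cancelʳ-< (∑ loss) _ _ (begin-strict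
      ∑ (λ x → c x * M G′ x) + ∑ loss  <⟨ +-monoʳ-< _ ∑loss<∑gain ⟩
      ∑ (λ x → c x * M G′ x) + ∑ gain  ≡⟨ ∑-distrib-+ (λ x → c x * M G′ x) gain ⟨
      ∑ (λ x → c x * M G′ x + gain x)  ≤⟨ ∑-mono (λ x →
        go x (inW W x) refl (x Fin.≟ u) (x Fin.≟ e) (G u x) refl (x Fin.≟ v₀) (x Fin.≟ P 1)) ⟩
      ∑ (λ x → c x * M G x + loss x)   ≡⟨ ∑-distrib-+ (λ x → c x * M G x) loss ⟩
      ∑ (λ x → c x * M G x) + ∑ loss   ∎)
      where
      open ≤-Reasoning
      regroup : ∀ x y a b → x + (y + (a + b)) ≡ a + (x + (y + b))
      regroup = solve-∀
      ∑loss<∑gain : ∑ loss < ∑ gain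
      ∑loss<∑gain = subst₂ _<_ (sym ∑-loss) (trans (sym (regroup (k * (h * q)) (h * (k * q)) a₁ a₂)) (sym ∑-gain)) (+-monoʳ-< a₁ win)
      plus-gain : ∀ {x g} → gain x ≡ g → c x * M G′ x + g ≤ c x * M G x + loss x →
        c x * M G′ x + gain x ≤ c x * M G x + loss x
      plus-gain {x} eq = subst (λ t → c x * M G′ x + t ≤ c x * M G x + loss x) (sym eq)
      no-loss : ∀ {x g} → c x * M G′ x + g ≤ c x * M G x → c x * M G′ x + g ≤ c x * M G x + loss x
      no-loss le = ≤-trans le (m≤m+n _ _)
      go : ∀ x b → inW W x ≡ b → Dec (x ≡ u) → Dec (x ≡ e) → ∀ b′ → G u x ≡ b′ → Dec (x ≡ v₀) → Dec (x ≡ P 1) →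
        c x * M G′ x + gain x ≤ c x * M G x + loss x
      go x true  w _ _ _ _ _ _ = plus-gain (gain-W w) (no-loss (scale-gain (c x) (M-W w) (q≤c x)))
      go x false w (yes refl) _ _ _ _ _ = plus-gain gain-u at-u
      go x false w (no x≢u) (yes refl) _ _ _ _ = plus-gain gain-e at-e
      go x false w (no x≢u) (no x≢e) true g _ _ = plus-gain (gain-plain w x≢u x≢e g) (no-loss (at-plain w g x≢e))
      go x false w (no x≢u) (no x≢e) false g (yes refl) _ = plus-gain (gain-other w x≢u x≢e g)
        (subst (_≤ c v₀ * M G v₀ + loss v₀) (sym (+-identityʳ _)) (≤-trans (at-v₀ g) (+-monoʳ-≤ _ loss-v₀)))
      go x false w (no x≢u) (no x≢e) false g (no x≢v₀) (yes refl) = plus-gain (gain-other w x≢u x≢e g)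
        (subst (_≤ c (P 1) * M G (P 1) + loss (P 1)) (sym (+-identityʳ _)) (≤-trans (at-v₁ x≢u x≢e) (+-monoʳ-≤ _ loss-v₁)))
      -- Not being `v₁`, such an `x` is not adjacent to `v₀` either.
      go x false w (no x≢u) (no x≢e) false g (no x≢v₀) (no x≢v₁) = plus-gain (gain-other w x≢u x≢e g)
        (no-loss (subst (_≤ c x * M G x) (sym (+-identityʳ _)) (*-monoʳ-≤ (c x)
          (M-other x≢u x≢v₀ w (trans (G-sym x u) g) (¬-not λ xv₀ → x≢v₁ (v₀-neighbour 0<D (swap-edge xv₀)))))))

  P≢u : ∀ {a} → a ≤ D → a ≢ j → P a ≢ u
  P≢u a≤D = P≢P a≤D j≤D

  M-neighbour-k : ∀ {x} → x ≢ v₀ → inW W x ≡ false → G u x ≡ true → G x v₀ ≡ false → M G′ x + k ≤ M G x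
  M-neighbour-k {x} x≢v₀ x∉W ux xv₀ = ≤-trans
    (+-monoʳ-≤ (M G′ x) (≤-trans (≤-reflexive (sym (*-identityʳ k))) (*-monoʳ-≤ k (cofactor≥1 x))))
    (M-neighbour x≢v₀ x∉W ux xv₀)

  -- The old product at `v₁` is at least `deg G (P 2)`, and the new one is at most `suc k` times
  -- that.
  M-v₁-loss : P 2 ≢ u → M G′ (P 1) ≤ M G (P 1) + k * deg G (P 2)
  M-v₁-loss v₂≢u = ≤-trans
    (M′-v₁ (true⇒1≤count (G (P 2)) (swap-edge (path-edge 1<D))) (deg′≤ v₂≢u v₂≢v₀))
    (+-monoˡ-≤ (k * deg G (P 2)) M-v₁≥)

  -- Here `u` is `v₁` and the moved vertices are leaves, so only the neighbour `u` matters for `v₀`,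
  -- and its degree falls by `k`.
  M-v₀-gain : i ≡ 0 → M G′ v₀ + k ≤ M G v₀
  M-v₀-gain i≡0 = begin
    M G′ v₀ + k        ≤⟨ +-monoˡ-≤ k (≤-trans (≤-reflexive (M≡∏ G′ v₀)) (∏≤-factor (factor G′ v₀) u others)) ⟩
    factor G′ v₀ u + k ≤⟨ +-monoˡ-≤ k (factor≤ G′ {v₀} {u} (s≤s z≤n) (λ _ → deg′-u)) ⟩
    suc h + k          ≡⟨ +-comm (suc h) k ⟩
    k + suc h          ≡⟨ deg-u ⟨
    deg G u            ≡⟨ factor-edge G v₀u ⟨
    factor G v₀ u      ≤⟨ factor≤∏ u (factor≥1 G-sym v₀) ⟩
    ∏ (factor G v₀)    ≡⟨ M≡∏ G v₀ ⟨
    M G v₀             ∎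
    where
    open ≤-Reasoning
    u≡v₁ : u ≡ P 1
    u≡v₁ = cong (P ∘ suc) i≡0
    v₀u : G v₀ u ≡ true
    v₀u = subst (λ x → G v₀ x ≡ true) (sym u≡v₁) (path-edge 0<D)
    others : ∀ y → y ≢ u → factor G′ v₀ y ≤ 1
    others y y≢u = factor≤ G′ ≤-refl λ g → case-edge (∨-true⁻ (G v₀ y) (trans (sym (G′-v₀ y)) g))
      where
      case-edge : G v₀ y ≡ true ⊎ inW W y ≡ true → deg G′ y ≤ 1
      case-edge (inj₁ g) = contradiction (trans (v₀-neighbour 0<D g) (sym u≡v₁)) y≢u
      case-edge (inj₂ w) = ≤-trans (deg′-W w)
        (v₁-neighbour-leaf 1<D (subst (λ x → G x y ≡ true) u≡v₁ (W-u w)) (W≢P {m = 2} 1<D w))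

  -- The neighbour set apart is `v₂`, whose gain has the weight `c (P 2)` in place of `q`. The loss
  -- at `v₁` is booked at `u`, which is the same vertex; `v₀` is one of the plain neighbours, and
  -- `a₁` is 0.
  decreases-v₁ : i ≡ 0 → k * deg G (P 2) * p < k * (h * q) + (h * (k * q) + k * c (P 2)) → Decreases
  decreases-v₁ i≡0 win = L.balance at-u at-e at-plain at-v₀ at-v₁ win
    where
    u≡v₁ : u ≡ P 1
    u≡v₁ = cong (P ∘ suc) i≡0
    uv₂ : G u (P 2) ≡ true
    uv₂ = subst (λ x → G x (P 2) ≡ true) (sym u≡v₁) (path-edge 1<D)
    v₀u : G v₀ u ≡ true
    v₀u = subst (λ x → G v₀ x ≡ true) (sym u≡v₁) (path-edge 0<D)
    module L = Ledger (P 2) uv₂ (P∉W 1<D) 0 (k * c (P 2)) (k * deg G (P 2) * p)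
    at-u : c u * M G′ u + 0 ≤ c u * M G u + L.loss u
    at-u = subst (λ x → c x * M G′ x + 0 ≤ c x * M G x + L.loss x) (sym u≡v₁)
      (subst (_≤ c (P 1) * M G (P 1) + L.loss (P 1)) (sym (+-identityʳ _))
        (≤-trans (scale-loss (c (P 1)) (M-v₁-loss (P≢u 1<D λ eq → contradiction (trans (suc-injective eq) i≡0) λ ())) c-v₁≤p)
          (+-monoʳ-≤ _ L.loss-v₁)))
    at-e : c (P 2) * M G′ (P 2) + k * c (P 2) ≤ c (P 2) * M G (P 2) + L.loss (P 2)
    at-e = ≤-trans (scale-gain (c (P 2)) (M-neighbour-k v₂≢v₀ (P∉W 1<D) uv₂ (non-adjacent 1<D z≤n (λ ()) (λ ()))) ≤-refl)
      (m≤m+n _ _)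
    at-plain : ∀ {x} → inW W x ≡ false → G u x ≡ true → x ≢ P 2 → c x * M G′ x + k * q ≤ c x * M G x
    at-plain {x} x∉W ux _ = scale-gain (c x) (go (x Fin.≟ v₀)) (q≤c x)
      where
      go : Dec (x ≡ v₀) → M G′ x + k ≤ M G x
      go (yes refl) = M-v₀-gain i≡0
      go (no x≢v₀)  = M-neighbour-k x≢v₀ x∉W ux (¬-not λ xv₀ → contradiction
        (trans (sym (G-irrefl u)) (subst (λ y → G u y ≡ true) (trans (v₀-neighbour 0<D (swap-edge xv₀)) (sym u≡v₁)) ux)) λ ())
    at-v₀ : G u v₀ ≡ false → c v₀ * M G′ v₀ ≤ c v₀ * M G v₀ + 0
    at-v₀ uv₀ = contradiction (trans (sym uv₀) (swap-edge v₀u)) λ ()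
    at-v₁ : P 1 ≢ u → P 1 ≢ P 2 → c (P 1) * M G′ (P 1) ≤ c (P 1) * M G (P 1) + k * deg G (P 2) * p
    at-v₁ v₁≢u _ = contradiction (sym u≡v₁) v₁≢u

  module _ (i≢0 : i ≢ 0) (v₁≤v_i : deg G (P 1) ≤ deg G (P i)) where

    uv₀≡false : G u v₀ ≡ false
    uv₀≡false = non-adjacent j≤D z≤n (λ eq → i≢0 (suc-injective eq)) λ ()

    transfer : ℕ
    transfer = M G v₀ * pred ∏W

    m*∏W : ∀ m → m * ∏W ≡ m + m * pred ∏W
    m*∏W m = trans (cong (m *_) (sym (suc-pred ∏W {{>-nonZero ∏W≥1}}))) (*-suc m (pred ∏W))

    -- Without the factor `∏W` the vertex `u` loses at least `M-rest * pred ∏W`, and `M-rest` is at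
    -- least `deg v_i`, hence at least `deg v₁` and `M G v₀`.
    M-u-gain : M G′ u + transfer ≤ M G u
    M-u-gain = begin
      M G′ u + transfer           ≤⟨ +-mono-≤ (M′-u uv₀≡false) (*-monoˡ-≤ (pred ∏W) (≤-trans M-v₀≤ (≤-trans v₁≤v_i deg-P-i≤M-rest))) ⟩
      M-rest + M-rest * pred ∏W   ≡⟨ m*∏W M-rest ⟨
      M-rest * ∏W                 ≡⟨ M-u ⟨
      M G u                       ∎
      where open ≤-Reasoning

    M-v₀-loss : M G′ v₀ ≤ M G v₀ + transfer
    M-v₀-loss = ≤-trans (M′-v₀ (trans (G-sym v₀ u) uv₀≡false)) (≤-reflexive (m*∏W (M G v₀)))

    -- The neighbour set apart is the predecessor `P i` of `u`. The alternatives separate `u = v₂`,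
    -- where `P i` is `v₁` and bears the loss `b₂` itself, from a later `u`, to which `v₁` is not
    -- adjacent. The cancelling amount is `transfer * q`, as the weight is at least `q` at `u` and
    -- at most `q` at `v₀`.
    decreases : ∀ a₂ b₂ → (P 1 ≡ P i ⊎ G u (P 1) ≡ false) →
      (c (P i) * M G′ (P i) + a₂ ≤ c (P i) * M G (P i) ⊎
        (P 1 ≡ P i × c (P 1) * M G′ (P 1) + a₂ ≤ c (P 1) * M G (P 1) + b₂)) →
      (P 1 ≢ P i → c (P 1) * M G′ (P 1) ≤ c (P 1) * M G (P 1) + b₂) →
      b₂ < k * (h * q) + (h * (k * q) + a₂) → Decreases
    decreases a₂ b₂ v₁-position at-e at-v₁ win = L.balance
      (≤-trans (scale-gain (c u) M-u-gain (q≤c u)) (m≤m+n _ _))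
      (case-e at-e)
      at-plain
      (λ _ → scale-loss (c v₀) M-v₀-loss c-v₀≤q)
      (λ _ → at-v₁)
      win
      where
      module L = Ledger (P i) (swap-edge (path-edge i<D)) (P∉W i≤D) (transfer * q) a₂ b₂
      case-e : _ → c (P i) * M G′ (P i) + a₂ ≤ c (P i) * M G (P i) + L.loss (P i)
      case-e (inj₁ le) = ≤-trans le (m≤m+n _ _)
      case-e (inj₂ (eq , le)) = subst (λ x → c x * M G′ x + a₂ ≤ c x * M G x + L.loss x) eq
        (≤-trans le (+-monoʳ-≤ _ L.loss-v₁))
      at-plain : ∀ {x} → inW W x ≡ false → G u x ≡ true → x ≢ P i → c x * M G′ x + k * q ≤ c x * M G x
      at-plain {x} x∉W ux x≢v_i = scale-gain (c x) (M-neighbour-k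
        (λ { refl → contradiction (trans (sym ux) uv₀≡false) λ () }) x∉W ux
        (¬-not λ xv₀ → not-v₁ v₁-position (v₀-neighbour 0<D (swap-edge xv₀)))) (q≤c x)
        where
        not-v₁ : P 1 ≡ P i ⊎ G u (P 1) ≡ false → x ≢ P 1
        not-v₁ (inj₁ eq) refl = x≢v_i eq
        not-v₁ (inj₂ ng) refl = contradiction (trans (sym ux) ng) λ ()

  -- The product at `v₁` becomes at most `suc k * suc h` and was at least `deg u = k + suc h`; the
  -- increase `k * h` has weight at most `p`. Against it, moved and staying neighbours together gain
  -- `2 * k * h * q`.
  decreases-v₂ : i ≡ 1 → p < 2 * q → Decreases
  decreases-v₂ i≡1 p<2q = decreases i≢0 (≤-reflexive (cong (deg G) v₁≡v_i)) 0 (k * h * p) (inj₁ v₁≡v_i)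
    (inj₂ (v₁≡v_i , subst (_≤ c (P 1) * M G (P 1) + k * h * p) (sym (+-identityʳ _)) (scale-loss (c (P 1)) v₁-loss c-v₁≤p)))
    (λ v₁≢v_i → contradiction v₁≡v_i v₁≢v_i)
    (begin-strict
      k * h * p                          <⟨ *-monoʳ-< (k * h) {{>-nonZero (*-mono-≤ 1≤k 1≤h)}} p<2q ⟩
      k * h * (2 * q)                    ≡⟨ regroup k h q ⟩
      k * (h * q) + (h * (k * q) + 0)    ∎)
    where
    open ≤-Reasoning
    regroup : ∀ k h q → k * h * (2 * q) ≡ k * (h * q) + (h * (k * q) + 0)
    regroup = solve-∀
    i≢0 : i ≢ 0
    i≢0 eq = contradiction (trans (sym i≡1) eq) λ ()
    v₁≡v_i : P 1 ≡ P i
    v₁≡v_i = cong P (sym i≡1)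
    u≡v₂ : u ≡ P 2
    u≡v₂ = cong (P ∘ suc) i≡1
    expand : ∀ k h → suc k * suc h ≡ (k + suc h) + k * h
    expand = solve-∀
    v₁-loss : M G′ (P 1) ≤ M G (P 1) + k * h
    v₁-loss = begin
      M G′ (P 1)             ≤⟨ M′-v₁ (s≤s z≤n) (subst (λ x → deg G′ x ≤ suc h) u≡v₂ deg′-u) ⟩
      suc k * suc h          ≡⟨ expand k h ⟩
      (k + suc h) + k * h    ≡⟨ cong (_+ k * h) (trans (sym deg-u) (cong (deg G) u≡v₂)) ⟩
      deg G (P 2) + k * h    ≤⟨ +-monoˡ-≤ (k * h) M-v₁≥ ⟩
      M G (P 1) + k * h      ∎

  -- The loss at `v₁` is at most `2 * k * p`, less than `4 * k * q`. Half of the latter is gained at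
  -- the moved and the plain neighbours, as `h` is at least 1; the other half at `P i`, whose
  -- cofactor is at least the degree of the interior vertex `P (suc i′)`.
  decreases-far : ∀ {i′} → i ≡ suc (suc i′) → deg G (P 1) ≤ 2 → deg G (P 2) ≤ 2 → p < 2 * q → Decreases
  decreases-far {i′} i≡ v₁≤2 v₂≤2 p<2q = decreases i≢0 v₁≤v_i (k * 2 * q) (k * deg G (P 2) * p)
    (inj₂ (non-adjacent j≤D (<⇒≤ 1<D) (λ eq → contradiction (trans (sym i≡) (suc-injective eq)) λ ())
      (λ eq → contradiction eq λ ())))
    (inj₁ (scale-gain (c (P i)) v_i-gain (q≤c (P i))))
    (λ _ → scale-loss (c (P 1)) (M-v₁-loss v₂≢u) c-v₁≤p)
    (begin-strict
      k * deg G (P 2) * p                  ≤⟨ *-monoˡ-≤ p (*-monoʳ-≤ k v₂≤2) ⟩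
      k * 2 * p                            <⟨ *-monoʳ-< (k * 2) {{>-nonZero (*-mono-≤ 1≤k (s≤s (z≤n {1})))}} p<2q ⟩
      k * 2 * (2 * q)                      ≡⟨ regroup₁ k q ⟩
      2 * (k * q) + k * 2 * q              ≤⟨ +-monoˡ-≤ (k * 2 * q) (*-monoˡ-≤ (k * q) (*-monoʳ-≤ 2 1≤h)) ⟩
      2 * h * (k * q) + k * 2 * q          ≡⟨ regroup₂ k h q ⟩
      k * (h * q) + (h * (k * q) + k * 2 * q) ∎)
    where
    open ≤-Reasoning
    regroup₁ : ∀ k q → k * 2 * (2 * q) ≡ 2 * (k * q) + k * 2 * q
    regroup₁ = solve-∀
    regroup₂ : ∀ k h q → 2 * h * (k * q) + k * 2 * q ≡ k * (h * q) + (h * (k * q) + k * 2 * q)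
    regroup₂ = solve-∀
    i≢0 : i ≢ 0
    i≢0 eq = contradiction (trans (sym i≡) eq) λ ()
    v₂≢u : P 2 ≢ u
    v₂≢u = P≢u 1<D λ eq → contradiction (trans eq (cong suc i≡)) λ ()
    v₁≤v_i : deg G (P 1) ≤ deg G (P i)
    v₁≤v_i = ≤-trans v₁≤2 (subst (λ m → 2 ≤ deg G (P m)) (sym i≡) (deg-interior (subst (_< D) i≡ i<D)))
    i′<D : suc (suc i′) ≤ D
    i′<D = subst (_≤ D) i≡ i≤D
    v_i-edge : G (P i) (P (suc i′)) ≡ true
    v_i-edge = subst (λ m → G (P m) (P (suc i′)) ≡ true) (sym i≡) (swap-edge (path-edge i′<D))
    v_i-gain : M G′ (P i) + k * 2 ≤ M G (P i)
    v_i-gain = ≤-trans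
      (+-monoʳ-≤ (M G′ (P i)) (*-monoʳ-≤ k (≤-trans (deg-interior i′<D)
        (cofactor≥deg v_i-edge (P≢u (<⇒≤ i′<D) λ eq → <⇒≢ (s≤s (≤-trans (n≤1+n (suc i′)) (≤-reflexive (sym i≡)))) eq)))))
      (M-neighbour (P≢P i≤D z≤n i≢0) (P∉W i≤D) (swap-edge (path-edge i<D))
        (non-adjacent i≤D z≤n (λ eq → contradiction (trans (sym i≡) eq) λ ()) λ ()))

-- Passage to rational numbers

/-≡ : ∀ a b m n → a * suc n ≡ b * suc m → (ℤ.+ a) /ℚ suc m ≡ (ℤ.+ b) /ℚ suc n
/-≡ a b m n eq = ℚ.fromℚᵘ-cong {mkℚᵘ (ℤ.+ a) m} {mkℚᵘ (ℤ.+ b) n} (*≡* (begin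
  ℤ.+ a ℤ.* ℤ.+ suc n   ≡⟨ ℤ.pos-* a (suc n) ⟨
  ℤ.+ (a * suc n)       ≡⟨ cong ℤ.+_ eq ⟩
  ℤ.+ (b * suc m)       ≡⟨ ℤ.pos-* b (suc m) ⟩
  ℤ.+ b ℤ.* ℤ.+ suc m   ∎))
  where open ≡-Reasoning

/-≤ : ∀ a b m n → a * suc n ≤ b * suc m → (ℤ.+ a) /ℚ suc m ≤ℚ (ℤ.+ b) /ℚ suc n
/-≤ a b m n le = ℚ.toℚᵘ-cancel-≤ (ℚᵘ.≤-respˡ-≃ (ℚᵘ.≃-sym (ℚ.toℚᵘ-fromℚᵘ (mkℚᵘ (ℤ.+ a) m)))
  (ℚᵘ.≤-respʳ-≃ (ℚᵘ.≃-sym (ℚ.toℚᵘ-fromℚᵘ (mkℚᵘ (ℤ.+ b) n)))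
    (*≤* (subst₂ ℤ._≤_ (ℤ.pos-* a (suc n)) (ℤ.pos-* b (suc m)) (ℤ.+≤+ le)))))

/-< : ∀ a b m → a < b → (ℤ.+ a) /ℚ suc m <ℚ (ℤ.+ b) /ℚ suc m
/-< a b m lt = ℚ.toℚᵘ-cancel-< (ℚᵘ.<-respˡ-≃ (ℚᵘ.≃-sym (ℚ.toℚᵘ-fromℚᵘ (mkℚᵘ (ℤ.+ a) m)))
  (ℚᵘ.<-respʳ-≃ (ℚᵘ.≃-sym (ℚ.toℚᵘ-fromℚᵘ (mkℚᵘ (ℤ.+ b) m)))
    (*<* (subst₂ ℤ._<_ (ℤ.pos-* a (suc m)) (ℤ.pos-* b (suc m)) (ℤ.+<+ (*-monoˡ-< (suc m) lt))))))

/-+ : ∀ a b m → (ℤ.+ a) /ℚ suc m +ℚ (ℤ.+ b) /ℚ suc m ≡ (ℤ.+ (a + b)) /ℚ suc m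
/-+ a b m = ℚ.toℚᵘ-injective (begin
  toℚᵘ (A +ℚ B)                                         ≈⟨ ℚ.toℚᵘ-homo-+ A B ⟩
  toℚᵘ A ℚᵘ.+ toℚᵘ B                                     ≈⟨ ℚᵘ.+-cong (ℚ.toℚᵘ-fromℚᵘ (mkℚᵘ (ℤ.+ a) m))
    (ℚ.toℚᵘ-fromℚᵘ (mkℚᵘ (ℤ.+ b) m)) ⟩
  mkℚᵘ (ℤ.+ a) m ℚᵘ.+ mkℚᵘ (ℤ.+ b) m                     ≈⟨ *≡* common ⟩
  mkℚᵘ (ℤ.+ (a + b)) m                                  ≈⟨ ℚ.toℚᵘ-fromℚᵘ (mkℚᵘ (ℤ.+ (a + b)) m) ⟨
  toℚᵘ ((ℤ.+ (a + b)) /ℚ suc m)                         ∎)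
  where
  open ℚᵘ.≃-Reasoning
  A B : ℚ
  A = (ℤ.+ a) /ℚ suc m
  B = (ℤ.+ b) /ℚ suc m
  s = ℤ.+ suc m
  common : (ℤ.+ a ℤ.* s ℤ.+ ℤ.+ b ℤ.* s) ℤ.* s ≡ ℤ.+ (a + b) ℤ.* (s ℤ.* s)
  common = trans (cong (ℤ._* s) (sym (ℤ.*-distribʳ-+ s (ℤ.+ a) (ℤ.+ b)))) (ℤ.*-assoc (ℤ.+ (a + b)) s s)

term-def : ∀ {n} (G : Graph n) x {e} → ecc G x ≡ suc e → term G x ≡ (ℤ.+ M G x) /ℚ suc e
term-def G x eq rewrite eq = refl

module _ {A : Set} (f : A → ℚ) (a : A → ℕ) (m : ℕ) where

  ∑ℚ-≤ : (∀ x → f x ≤ℚ (ℤ.+ a x) /ℚ suc m) → ∀ xs → foldr _+ℚ_ 0ℚ (map f xs) ≤ℚ (ℤ.+ sum (map a xs)) /ℚ suc m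
  ∑ℚ-≤ f≤ []       = /-≤ 0 0 0 m z≤n
  ∑ℚ-≤ f≤ (x ∷ xs) = ℚ.≤-trans (ℚ.+-mono-≤ (f≤ x) (∑ℚ-≤ f≤ xs)) (ℚ.≤-reflexive (/-+ (a x) (sum (map a xs)) m))

  ∑ℚ-≡ : (∀ x → f x ≡ (ℤ.+ a x) /ℚ suc m) → ∀ xs → foldr _+ℚ_ 0ℚ (map f xs) ≡ (ℤ.+ sum (map a xs)) /ℚ suc m
  ∑ℚ-≡ f≡ []       = /-≡ 0 0 0 m refl
  ∑ℚ-≡ f≡ (x ∷ xs) = trans (cong₂ _+ℚ_ (f≡ x) (∑ℚ-≡ f≡ xs)) (/-+ (a x) (sum (map a xs)) m)

-- Over the common denominator `L` the terms of `G` have exactly the numerators `c x * M G x`. Those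
-- of `G′` are at most `c x * M G′ x`, because a larger eccentricity only lowers them.
xiac-< : ∀ {n} (G G′ : Graph n) (c : Fin n → ℕ) L → 1 ≤ L →
  (∀ x → 1 ≤ ecc G x) → (∀ x → ecc G x ≤ ecc G′ x) → (∀ x → c x * ecc G x ≡ L) →
  ∑ (λ x → c x * M G′ x) < ∑ (λ x → c x * M G x) → xiac G′ <ℚ xiac G
xiac-< {n} G G′ c (suc L) _ 1≤ecc ecc≤ c*ecc lt = ℚ.≤-<-trans
  (∑ℚ-≤ (term G′) (λ x → c x * M G′ x) L term′≤ (allFin n))
  (ℚ.<-≤-trans
    (/-< _ _ L (subst₂ _<_ (sym (sum-allFin (λ x → c x * M G′ x))) (sym (sum-allFin (λ x → c x * M G x))) lt))
    (ℚ.≤-reflexive (sym (∑ℚ-≡ (term G) (λ x → c x * M G x) L term≡ (allFin n)))))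
  where
  rearrange : ∀ m c e → m * (c * e) ≡ c * m * e
  rearrange = solve-∀
  successor : ∀ {e} → 1 ≤ e → ∃ λ e′ → e ≡ suc e′
  successor (s≤s _) = _ , refl
  term≡ : ∀ x → term G x ≡ (ℤ.+ (c x * M G x)) /ℚ suc L
  term≡ x with successor (1≤ecc x)
  ... | e , eq = trans (term-def G x eq) (/-≡ (M G x) (c x * M G x) e L
    (trans (cong (M G x *_) (trans (sym (c*ecc x)) (cong (c x *_) eq))) (rearrange (M G x) (c x) (suc e))))
  term′≤ : ∀ x → term G′ x ≤ℚ (ℤ.+ (c x * M G′ x)) /ℚ suc L
  term′≤ x with successor (≤-trans (1≤ecc x) (ecc≤ x))
  ... | e , eq = subst (_≤ℚ _) (sym (term-def G′ x eq)) (/-≤ (M G′ x) (c x * M G′ x) e L (begin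
    M G′ x * suc L            ≡⟨ cong (M G′ x *_) (c*ecc x) ⟨
    M G′ x * (c x * ecc G x)  ≤⟨ *-monoʳ-≤ (M G′ x) (*-monoʳ-≤ (c x) (subst (ecc G x ≤_) eq (ecc≤ x))) ⟩
    M G′ x * (c x * suc e)    ≡⟨ rearrange (M G′ x) (c x) (suc e) ⟩
    c x * M G′ x * suc e      ∎))
    where open ≤-Reasoning

∣! : ∀ {e D} → 1 ≤ e → e ≤ D → e ∣ D !
∣! {suc e} _ e≤D = ∣-trans (m∣m*n (e !)) (m≤n⇒m!∣n! e≤D)

-- `D !` is a common multiple of all eccentricities between 1 and `D`, which makes these quotients
-- exact.
weight : ∀ D {e} → 1 ≤ e → e ≤ D → ℕ
weight D 1≤e e≤D = _∣_.quotient (∣! 1≤e e≤D)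

weight-* : ∀ D {e} (1≤e : 1 ≤ e) (e≤D : e ≤ D) → weight D 1≤e e≤D * e ≡ D !
weight-* D 1≤e e≤D = sym (_∣_.equality (∣! 1≤e e≤D))

cofactor-antitone : ∀ {c₁ c₂ e₁ e₂} → 1 ≤ e₁ → e₁ ≤ e₂ → c₁ * e₁ ≡ c₂ * e₂ → c₂ ≤ c₁
cofactor-antitone {c₁} {c₂} {e₁} 1≤e₁ e₁≤e₂ eq = *-cancelʳ-≤ c₂ c₁ e₁ {{>-nonZero 1≤e₁}}
  (≤-trans (*-monoʳ-≤ c₂ e₁≤e₂) (≤-reflexive (sym eq)))

-- The weights of the vertices and the resulting cases

module Decrease {n k} (G : Graph n) (tree : IsTree G) (P : ℕ → Fin n) (diametric : Diametric G P)
  (i : ℕ) (j<D : suc i < diam G)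
  (W : Fin k → Fin n)
  (W-adj : ∀ a → G (P (suc i)) (W a) ≡ true)
  (W-off : ∀ a m → m ≤ diam G → W a ≢ P m)
  (W-inj : Injective _≡_ _≡_ W)
  (1≤k : 1 ≤ k) (h : ℕ) (1≤h : 1 ≤ h) (deg-u : deg G (P (suc i)) ≡ k + suc h)
  where

  open DiametricPath G tree P diametric

  private
    0<D : 0 < D
    0<D = ≤-trans (s≤s z≤n) (<⇒≤ j<D)

    1<D : 1 < D
    1<D = ≤-trans (s≤s (s≤s z≤n)) j<D

    D-1≥1 : 1 ≤ D ∸ 1
    D-1≥1 = ∸-monoˡ-≤ 1 1<D

    D-1≤D : D ∸ 1 ≤ D
    D-1≤D = m∸n≤m D 1

    c : Fin n → ℕ
    c x = weight D (1≤ecc 0<D x) (ecc≤diam G x)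

    p q : ℕ
    p = weight D D-1≥1 D-1≤D
    q = weight D 0<D ≤-refl

    c-* : ∀ x → c x * ecc G x ≡ D !
    c-* x = weight-* D (1≤ecc 0<D x) (ecc≤diam G x)

    p-* : p * (D ∸ 1) ≡ D !
    p-* = weight-* D D-1≥1 D-1≤D

    q-* : q * D ≡ D !
    q-* = weight-* D 0<D ≤-refl

    1≤q : 1 ≤ q
    1≤q = n≢0⇒n>0 λ eq → contradiction (trans (sym q-*) (cong (_* D) eq)) (≢-nonZero⁻¹ (D !) {{D !≢0}})

    q≤c : ∀ x → q ≤ c x
    q≤c x = cofactor-antitone (1≤ecc 0<D x) (ecc≤diam G x) (trans (c-* x) (sym q-*))

    c-v₁≤p : c (P 1) ≤ p
    c-v₁≤p = cofactor-antitone D-1≥1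
      (≤-trans (≤-reflexive (trans (sym (dist-end 0<D)) (dist-sym v_D (P 1)))) (dist≤ecc G (P 1) v_D))
      (trans p-* (sym (c-* (P 1))))

    c-v₀≤q : c v₀ ≤ q
    c-v₀≤q = cofactor-antitone 0<D (≤-trans (≤-reflexive (sym ends)) (dist≤ecc G v₀ v_D)) (trans q-* (sym (c-* v₀)))

    -- From `v₂` the ends are at distances 2 and `D ∸ 2`, neither more than `D ∸ 1`.
    p≤c-v₂ : 2 < D → p ≤ c (P 2)
    p≤c-v₂ 2<D = cofactor-antitone (1≤ecc 0<D (P 2))
      (ecc≤-from-ends ends (P 2)
        (≤-trans (≤-reflexive (trans (dist-sym (P 2) v₀) (dist-start 1<D))) (∸-monoˡ-≤ 1 2<D))
        (≤-trans (≤-reflexive (trans (dist-sym (P 2) v_D) (dist-end 1<D))) (∸-monoʳ-≤ D (s≤s z≤n))))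
      (trans (c-* (P 2)) (sym p-*))

    double : ∀ q m → 2 * q * m ≡ q * (m + m)
    double = solve-∀

    -- Both `p * (D ∸ 1)` and `q * D` are `D !`, so this amounts to `D ≤ 2 * (D ∸ 1)`, which holds
    -- from `D = 2` on and is strict beyond.
    p≤2q : p ≤ 2 * q
    p≤2q = *-cancelʳ-≤ p (2 * q) (D ∸ 1) {{>-nonZero D-1≥1}} (begin
      p * (D ∸ 1)               ≡⟨ trans p-* (sym q-*) ⟩
      q * D                     ≡⟨ cong (q *_) (m∸n+n≡m 0<D) ⟨
      q * (D ∸ 1 + 1)           ≤⟨ *-monoʳ-≤ q (+-monoʳ-≤ (D ∸ 1) D-1≥1) ⟩
      q * (D ∸ 1 + (D ∸ 1))     ≡⟨ double q (D ∸ 1) ⟨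
      2 * q * (D ∸ 1)           ∎)
      where open ≤-Reasoning

    p<2q : 2 < D → p < 2 * q
    p<2q 2<D = *-cancelʳ-< (D ∸ 1) p (2 * q) (begin-strict
      p * (D ∸ 1)               ≡⟨ trans p-* (sym q-*) ⟩
      q * D                     ≡⟨ cong (q *_) (m∸n+n≡m 0<D) ⟨
      q * (D ∸ 1 + 1)           <⟨ *-monoʳ-< q {{>-nonZero 1≤q}} (+-monoʳ-< (D ∸ 1) (∸-monoˡ-≤ 1 2<D)) ⟩
      q * (D ∸ 1 + (D ∸ 1))     ≡⟨ double q (D ∸ 1) ⟨
      2 * q * (D ∸ 1)           ∎)
      where open ≤-Reasoning

  open WeightedSum G tree P diametric i j<D W W-adj W-off W-inj 1≤k h 1≤h deg-u c p q q≤c c-v₁≤p c-v₀≤q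
    using (Decreases; decreases-v₁; decreases-v₂; decreases-far; G′; G′-def; ecc-grows)

  private
    xiac-decreases : Decreases → xiac (moveEdges G (P (suc i)) v₀ W) <ℚ xiac G
    xiac-decreases lt = subst (λ H → xiac H <ℚ xiac G) G′-def
      (xiac-< G G′ c (D !) (n≢0⇒n>0 (≢-nonZero⁻¹ (D !) {{D !≢0}})) (1≤ecc 0<D) ecc-grows c-* lt)

    2kq≤ : k * (2 * q) ≤ k * (h * q) + h * (k * q)
    2kq≤ = ≤-trans (*-monoʳ-≤ k (*-monoˡ-≤ q (*-monoʳ-≤ 2 1≤h))) (≤-reflexive (regroup k h q))
      where
      regroup : ∀ k h q → k * (2 * h * q) ≡ k * (h * q) + h * (k * q)
      regroup = solve-∀

  -- Meant for `D = 2`, where `v₂` is a leaf and `p` equals `2 * q`; the strictness comes from the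
  -- gain `k * c (P 2)` at `v₂`.
  xiac-v₁-star : i ≡ 0 → deg G (P 2) ≤ 1 → xiac (moveEdges G (P (suc i)) v₀ W) <ℚ xiac G
  xiac-v₁-star i≡0 v₂≤1 = xiac-decreases (decreases-v₁ i≡0 (begin-strict
    k * deg G (P 2) * p                                 ≤⟨ *-mono-≤ (*-monoʳ-≤ k v₂≤1) p≤2q ⟩
    k * 1 * (2 * q)                                     ≡⟨ cong (_* (2 * q)) (*-identityʳ k) ⟩
    k * (2 * q)                                         ≤⟨ 2kq≤ ⟩
    k * (h * q) + h * (k * q)                           <⟨ m<m+n _ (*-mono-≤ 1≤k (≤-trans 1≤q (q≤c (P 2)))) ⟩
    k * (h * q) + h * (k * q) + k * c (P 2)             ≡⟨ +-assoc (k * (h * q)) _ _ ⟩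
    k * (h * q) + (h * (k * q) + k * c (P 2))           ∎))
    where open ≤-Reasoning

  -- One half of the loss `2 * k * p` is less than `k * (2 * q)`, gained at the moved and the plain
  -- neighbours; the other half is at most the gain `k * c (P 2)` at `v₂`.
  xiac-v₁ : i ≡ 0 → 2 < D → deg G (P 2) ≤ 2 → xiac (moveEdges G (P (suc i)) v₀ W) <ℚ xiac G
  xiac-v₁ i≡0 2<D v₂≤2 = xiac-decreases (decreases-v₁ i≡0 (begin-strict
    k * deg G (P 2) * p                                 ≤⟨ *-monoˡ-≤ p (*-monoʳ-≤ k v₂≤2) ⟩
    k * 2 * p                                           ≡⟨ regroup k p ⟩
    k * p + k * p                                       <⟨ +-mono-<-≤ (*-monoʳ-< k {{>-nonZero 1≤k}} (p<2q 2<D)) (*-monoʳ-≤ k (p≤c-v₂ 2<D)) ⟩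
    k * (2 * q) + k * c (P 2)                           ≤⟨ +-monoˡ-≤ (k * c (P 2)) 2kq≤ ⟩
    k * (h * q) + h * (k * q) + k * c (P 2)             ≡⟨ +-assoc (k * (h * q)) _ _ ⟩
    k * (h * q) + (h * (k * q) + k * c (P 2))           ∎))
    where
    open ≤-Reasoning
    regroup : ∀ k p → k * 2 * p ≡ k * p + k * p
    regroup = solve-∀

  xiac-v₂ : i ≡ 1 → xiac (moveEdges G (P (suc i)) v₀ W) <ℚ xiac G
  xiac-v₂ i≡1 = xiac-decreases (decreases-v₂ i≡1 (p<2q (subst (λ m → suc m < D) i≡1 j<D)))

  xiac-far : ∀ {i′} → i ≡ suc (suc i′) → deg G (P 1) ≤ 2 → deg G (P 2) ≤ 2 →
    xiac (moveEdges G (P (suc i)) v₀ W) <ℚ xiac G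
  xiac-far i≡ v₁≤2 v₂≤2 = xiac-decreases (decreases-far i≡ v₁≤2 v₂≤2
    (p<2q (≤-trans (s≤s (s≤s (s≤s z≤n))) (subst (λ m → suc m < D) i≡ j<D))))

-- Cases by the position of the first branching vertex

split-degree : ∀ d {k} → 1 ≤ k → k ≤ d ∸ 2 → ∃ λ h → 1 ≤ h × d ≡ k + suc h
split-degree zero          1≤k k≤ = contradiction (≤-trans 1≤k k≤) λ ()
split-degree (suc zero)    1≤k k≤ = contradiction (≤-trans 1≤k k≤) λ ()
-- Here `d` is the degree less 2, so the witness is the degree minus `k + 1`.
split-degree (suc (suc d)) {k} 1≤k k≤ = suc (d ∸ k) , s≤s z≤n , (begin
  2 + d                 ≡⟨ cong (2 +_) (m+[n∸m]≡n k≤) ⟨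
  2 + (k + (d ∸ k))     ≡⟨ shift k (d ∸ k) ⟩
  k + suc (suc (d ∸ k)) ∎)
  where
  open ≡-Reasoning
  shift : ∀ a b → 2 + (a + b) ≡ a + suc (suc b)
  shift = solve-∀

theorem2 : ∀ {n} (T : Graph n) → IsTree T → ¬ Isomorphic T (pathGraph n)
    → (P : ℕ → Fin n) → Diametric T P
    → (i : ℕ) → FirstBranch T P i
    → (∀ (Q : ℕ → Fin n) (j : ℕ) → Diametric T Q → FirstBranch T Q j → j ≤ i)
    → (u : Fin n)
    → ((2 < diam T × i ≡ 1 × 2 < deg T (P 2)) → u ≡ P 2)
    → (¬ (2 < diam T × i ≡ 1 × 2 < deg T (P 2)) → u ≡ P i)
    → (k : ℕ) → 1 ≤ k → k ≤ deg T u ∸ 2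
    → (W : Fin k → Fin n) → Injective _≡_ _≡_ W
    → (∀ a → T u (W a) ≡ true)
    → (∀ a j → j ≤ diam T → W a ≢ P j)
    → xiac (moveEdges T u (P 0) W) <ℚ xiac T
theorem2 {n} T tree _ P diametric i (i≤D , branching , before) _ u special normal k 1≤k k≤ W W-inj W-adj W-off =
  main (2 <? diam T) (i ≟ 1) (2 <? deg T (P 2))
  where
  open DiametricPath T tree P diametric using (deg-v₀≤1; deg-v_D≤1)

  Goal : Set
  Goal = xiac (moveEdges T u (P 0) W) <ℚ xiac T

  h = proj₁ (split-degree (deg T u) 1≤k k≤)
  1≤h = proj₁ (proj₂ (split-degree (deg T u) 1≤k k≤))
  deg-u = proj₂ (proj₂ (split-degree (deg T u) 1≤k k≤))

  -- A branching vertex cannot be the end `v_D`, which is a leaf.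
  i<D : i < diam T
  i<D = ≤∧≢⇒< i≤D λ { refl → contradiction (≤-trans branching deg-v_D≤1) λ { (s≤s ()) } }

  module At (m : ℕ) (m<D : suc m < diam T) (u≡ : u ≡ P (suc m)) = Decrease T tree P diametric m m<D W
    (subst (λ x → ∀ a → T x (W a) ≡ true) u≡ W-adj) W-off W-inj 1≤k h 1≤h
    (subst (λ x → deg T x ≡ k + suc h) u≡ deg-u)

  conclude : ∀ {m} → u ≡ P m → xiac (moveEdges T (P m) (P 0) W) <ℚ xiac T → Goal
  conclude u≡ = subst (λ x → xiac (moveEdges T x (P 0) W) <ℚ xiac T) (sym u≡)

  non-branching : ∀ m → m < i → deg T (P m) ≤ 2
  non-branching m m<i = s≤s⁻¹ (≰⇒> (before m m<i))

  deg-v₂≤1 : ¬ 2 < diam T → 1 < diam T → deg T (P 2) ≤ 1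
  deg-v₂≤1 2≮D 1<D = subst (λ m → deg T (P m) ≤ 1) (≤-antisym (≮⇒≥ 2≮D) 1<D) deg-v_D≤1

  -- The second premise records that the exceptional choice of `v₂` does not apply.
  at-v_i : u ≡ P i → (i ≡ 1 → 2 < diam T → deg T (P 2) ≤ 2) → Goal
  at-v_i u≡ v₂≤2 = go i refl
    where
    go : ∀ m → i ≡ m → Goal
    go 0 refl = contradiction (≤-trans branching deg-v₀≤1) λ { (s≤s ()) }
    go 1 refl with 2 <? diam T
    ... | yes 2<D = conclude u≡ (At.xiac-v₁ 0 i<D u≡ refl 2<D (v₂≤2 refl 2<D))
    -- The diameter is 2 here, so `v₂` is the end `v_D`.
    ... | no 2≮D  = conclude u≡ (At.xiac-v₁-star 0 i<D u≡ refl (deg-v₂≤1 2≮D i<D))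
    go 2 refl = conclude u≡ (At.xiac-v₂ 1 i<D u≡ refl)
    -- Both `v₁` and `v₂` precede the first branching vertex.
    go (suc (suc (suc m))) refl = conclude u≡ (At.xiac-far (suc (suc m)) i<D u≡ refl
      (non-branching 1 (s≤s (s≤s z≤n))) (non-branching 2 (s≤s (s≤s (s≤s z≤n)))))

  main : Dec (2 < diam T) → Dec (i ≡ 1) → Dec (2 < deg T (P 2)) → Goal
  -- The exceptional `u = v₂` lies one past the first branching vertex, and is treated like a first
  -- branching vertex at index 2.
  main (yes 2<D) (yes i≡1) (yes 2<v₂) = let u≡ = special (2<D , i≡1 , 2<v₂) in conclude u≡ (At.xiac-v₂ 1 2<D u≡ refl)
  main (no 2≮D)  _         _          = at-v_i (normal λ (2<D , _) → 2≮D 2<D) λ _ 2<D → contradiction 2<D 2≮D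
  main _         (no i≢1)  _          = at-v_i (normal λ (_ , i≡1 , _) → i≢1 i≡1) λ i≡1 _ → contradiction i≡1 i≢1
  main _         _         (no 2≮v₂)  = at-v_i (normal λ (_ , _ , 2<v₂) → 2≮v₂ 2<v₂) λ _ _ → ≮⇒≥ 2≮v₂
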